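{- The set of all good odd positive integers has positive lower asymptotic density.
   Context: An odd positive integer $m$ is called good if for every integer $a$ the congruence $x^k-x^{k-1}\equiv a \pmod m$ has a solution with $k$ a positive integer and $x$ an integer satisfying $\gcd(x,m)=1$. -}

module Defs where

open import Data.Nat as ℕ using (ℕ; suc; _≤_; _*_)
open import Data.Nat.Divisibility as ℕD using ()
open import Data.Integer as ℤ using (ℤ; +_; _-_; _^_; 1ℤ)
open import Data.Integer.GCD using (gcd)
open import Data.Integer.Divisibility using (_∣_)
open import Data.Product using (Σ; ∃; _×_)
open import Data.List using (List; length)
open import Data.List.Relation.Unary.All using (All)
open import Data.List.Relation.Unary.Unique.Propositional using (Unique)
open import Relation.Binary.PropositionalEquality using (_≡_)
open import Relation.Nullary using (¬_)

Odd : ℕ → Set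
Odd m = ¬ (2 ℕD.∣ m)

Good : ℕ → Set
Good m = (a : ℤ) → Σ ℕ λ j → Σ ℤ λ x →
  (gcd x (+ m) ≡ 1ℤ) × ((+ m) ∣ ((x ^ suc j - x ^ j) - a))

GoodOddPos : ℕ → Set
GoodOddPos m = 1 ≤ m × Odd m × Good m

-- The set P ⊆ ℕ has positive lower asymptotic density:
-- there are positive naturals p, q (c = p/q > 0) and N₀ such that for all
-- N ≥ N₀, the set P ∩ [1, N] has at least (p/q)·N elements, i.e. there is a
-- duplicate-free list of elements of P ∩ [1, N] of length ℓ with q·ℓ ≥ p·N.
PositiveLowerDensity : (ℕ → Set) → Set
PositiveLowerDensity P =
  Σ ℕ λ p → Σ ℕ λ q → 1 ≤ p × 1 ≤ q × Σ ℕ λ N₀ → (N : ℕ) → N₀ ≤ N →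
    Σ (List ℕ) λ xs → Unique xs × All (λ m → 1 ≤ m × m ≤ N × P m) xs
      × (p * N ≤ q * length xs)

{-# OPTIONS --safe #-}
module Submission where

-- For a prime p write p − 1 = A R, and let μ be the group of R-th roots of unity mod p.  A variance count
-- of incidences between the points of μ × μ and the lines of the plane shows that, if A is small and R has
-- no small prime factor, then every a ≢ 0 is of the form (x − 1) / t with t ∈ μ and x a generator of μ.
-- Hence x^j (x − 1) ≡ a (mod p) can be solved with j prescribed modulo any L coprime to R.  If m is
-- squarefree and at every prime p ∣ m one can take R coprime to q − 1 for all smaller primes q ∣ m, the
-- exponents are chosen prime by prime, in increasing order, and m is good.
--
-- It remains to see that positively many m ≡ 1 (mod W) have these properties, W being divisible by all
-- small primes.  In the dyadic block p ≈ 2^i let R be the part of p − 1 free of prime factors up to a fixed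
-- power of i.  The bad events (p² ∣ m; p ∣ m with A large; q p ∣ m with a large common factor of p − 1 and
-- q − 1) have total weight O(1/i²), even if p and q run over all integers, so primes need not be counted.

open import Algebra.Bundles using (CommutativeRing)
open import Data.Empty using (⊥-elim)
open import Data.Fin using (Fin; toℕ; fromℕ<) renaming (zero to fzero; suc to fsuc)
open import Data.Fin.Permutation using (Permutation; permutation; _⟨$⟩ʳ_)
open import Data.Fin.Properties using (toℕ-injective; toℕ-fromℕ<; toℕ<n; any?) renaming (_≟_ to _≟F_; suc-injective to fsuc-injective)
open import Data.Integer as ℤ using (ℤ) renaming (+_ to pos)
import Data.Integer.Divisibility as ℤ
import Data.Integer.Divisibility.Signed as Signed
open import Data.Integer.DivMod using (_%ℕ_; _/ℕ_; a≡a%ℕn+[a/ℕn]*n)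
import Data.Integer.Properties as ℤ
import Data.Integer.Tactic.RingSolver as ℤSolver
open import Data.List using (List; []; _∷_; length)
open import Data.List.Membership.Propositional using (_∈_)
open import Data.List.Relation.Unary.All as All using (All; []; _∷_; all?)
open import Data.List.Relation.Unary.AllPairs using ([]; _∷_)
open import Data.List.Relation.Unary.Any using (Any; here; there)
open import Data.List.Relation.Unary.Unique.Propositional using (Unique)
open import Data.Nat
open import Data.Nat.Coprimality using (Coprime; coprime-Bézout; coprime-divisor; coprime⇒gcd≡1; prime⇒coprime)
open import Data.Nat.DivMod
open import Data.Nat.Divisibility
open import Data.Nat.GCD using (gcd; gcd-GCD; gcd[m,n]∣m; gcd[m,n]∣n; gcd-greatest; module Bézout)
open import Data.Nat.ListAction using (product)
open import Data.Nat.Primality using (Prime; prime?; prime⇒nonTrivial; prime⇒nonZero; prime⇒irreducible; euclidsLemma; ¬prime[0]; ¬prime[1])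
open import Data.Nat.Primality.Factorisation using (factorise; factorisationHasAllPrimeFactors)
open import Data.Nat.Properties
open import Data.Nat.Tactic.RingSolver using (solve-∀)
open import Data.Product using (Σ; ∃; _×_; _,_; proj₁; proj₂)
open import Data.Sum using (_⊎_; inj₁; inj₂)
open import Function using (_∘_)
open import Relation.Binary using (tri<; tri≈; tri>)
open import Relation.Binary.PropositionalEquality hiding (J)
open import Relation.Nullary using (¬_; Dec; yes; no)
open import Relation.Nullary.Decidable using (_×-dec_; ¬?)
open import Algebra.Properties.Semiring.Sum +-*-semiring using (sum; sum-cong-≗; sum-permute; ∑-comm; ∑-distrib-+; *-distribˡ-sum; *-distribʳ-sum)
open import Defs

-- Sums over Fin n and indicators

-- The residue of x may be chosen separately at each prime, but the exponent is common to all of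
-- them, and the numbers p - 1 share factors: this is the obstacle. Asking that x^j be 1 / t inside
-- μ constrains j only modulo R, and R avoids the small factors that many p - 1 have in common. The
-- variance argument needs R² to exceed p^(3/2) by a factor of order log p. In block i the bound for
-- A is 2 to a power of order (log i)², so R is almost as large as p. The size of the power of i
-- comes from the pairs. A common factor ℓ > β of p - 1 and q - 1 has weight about 1/ℓ² for each
-- pair of blocks; summed over ℓ and over the blocks of q up to i this is about i/β, which has to be
-- O(1/i²). Hence β is of order i³. A further obstacle is that the moduli p q may exceed the length
-- of the progression. Counting multiples then loses a factor W, and the tail of Σ 1/i² beyond i₀ +
-- W pays for it.

𝟙 : {P : Set} → Dec P → ℕ
𝟙 (yes _) = 1
𝟙 (no  _) = 0

𝟙≤1 : {P : Set} (d : Dec P) → 𝟙 d ≤ 1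
𝟙≤1 (yes _) = ≤-refl
𝟙≤1 (no  _) = z≤n

𝟙-yes : {P : Set} (d : Dec P) → P → 𝟙 d ≡ 1
𝟙-yes (yes _) _ = refl
𝟙-yes (no ¬p) p = ⊥-elim (¬p p)

𝟙-no : {P : Set} (d : Dec P) → ¬ P → 𝟙 d ≡ 0
𝟙-no (yes p) ¬p = ⊥-elim (¬p p)
𝟙-no (no _)  _  = refl

𝟙-mono : {P Q : Set} (d : Dec P) (e : Dec Q) → (P → Q) → 𝟙 d ≤ 𝟙 e
𝟙-mono (no _)  e f = z≤n
𝟙-mono (yes p) e f = ≤-reflexive (sym (𝟙-yes e (f p)))

𝟙-cong : {P Q : Set} (d : Dec P) (e : Dec Q) → (P → Q) → (Q → P) → 𝟙 d ≡ 𝟙 e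
𝟙-cong d e f g = ≤-antisym (𝟙-mono d e f) (𝟙-mono e d g)

abstract
  ∑ : ∀ {n} → (Fin n → ℕ) → ℕ
  ∑ = sum

  ∑-cong : ∀ {n} {f g : Fin n → ℕ} → (∀ i → f i ≡ g i) → ∑ f ≡ ∑ g
  ∑-cong = sum-cong-≗

  ∑-mono : ∀ {n} {f g : Fin n → ℕ} → (∀ i → f i ≤ g i) → ∑ f ≤ ∑ g
  ∑-mono {zero}  f≤g = z≤n
  ∑-mono {suc n} f≤g = +-mono-≤ (f≤g fzero) (∑-mono (f≤g ∘ fsuc))

  ∑-const : ∀ {n} c → ∑ {n} (λ _ → c) ≡ n * c
  ∑-const {zero}  c = refl
  ∑-const {suc n} c = cong (c +_) (∑-const {n} c)

  ∑-+ : ∀ {n} (f g : Fin n → ℕ) → ∑ (λ i → f i + g i) ≡ ∑ f + ∑ g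
  ∑-+ = ∑-distrib-+

  ∑-swap : ∀ {m n} (f : Fin m → Fin n → ℕ) → ∑ (λ i → ∑ (λ j → f i j)) ≡ ∑ (λ j → ∑ (λ i → f i j))
  ∑-swap = ∑-comm

  ∑-*ˡ : ∀ {n} c (f : Fin n → ℕ) → ∑ (λ i → c * f i) ≡ c * ∑ f
  ∑-*ˡ c f = sym (*-distribˡ-sum c f)

  ∑-*ʳ : ∀ {n} c (f : Fin n → ℕ) → ∑ (λ i → f i * c) ≡ ∑ f * c
  ∑-*ʳ c f = sym (*-distribʳ-sum c f)

  ∑-permute : ∀ {n} (f : Fin n → ℕ) (π : Permutation n n) → ∑ (λ i → f (π ⟨$⟩ʳ i)) ≡ ∑ f
  ∑-permute f π = sym (sum-permute f π)

  ∑-zero : ∀ {n} {f : Fin n → ℕ} → (∀ i → f i ≡ 0) → ∑ f ≡ 0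
  ∑-zero {n} e = trans (∑-cong e) (trans (∑-const {n} 0) (*-zeroʳ n))

  ∑-≟ : ∀ {n} (r : Fin n) → ∑ (λ x → 𝟙 (x ≟F r)) ≡ 1
  ∑-≟ {suc n} fzero    = cong suc (∑-zero {n} (λ _ → refl))
  ∑-≟ {suc n} (fsuc r) = trans (∑-cong {f = λ x → 𝟙 (fsuc x ≟F fsuc r)}
    (λ x → 𝟙-cong (fsuc x ≟F fsuc r) (x ≟F r) fsuc-injective (cong fsuc))) (∑-≟ r)

  term≤∑ : ∀ {n} (f : Fin n → ℕ) i → f i ≤ ∑ f
  term≤∑ f fzero    = m≤m+n _ _
  term≤∑ f (fsuc i) = ≤-trans (term≤∑ (f ∘ fsuc) i) (m≤n+m _ _)

-- The expansion of (a - b)² needed for the variance, with the cross term on the left since ℕ has no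
-- negative numbers.
∣-∣-square : ∀ a b → ∣ a - b ∣ * ∣ a - b ∣ + 2 * (a * b) ≡ a * a + b * b
∣-∣-square zero    b       = +-identityʳ (b * b)
∣-∣-square (suc a) zero    = cong (suc a * suc a +_) (cong (2 *_) (*-zeroʳ (suc a)))
∣-∣-square (suc a) (suc b) = trans (lem₁ ∣ a - b ∣ a b) (trans (cong (_+ (2 * a + 2 * b + 2)) (∣-∣-square a b)) (lem₂ a b))
  where
  lem₁ : ∀ d a b → d * d + 2 * (suc a * suc b) ≡ d * d + 2 * (a * b) + (2 * a + 2 * b + 2)
  lem₁ = solve-∀
  lem₂ : ∀ a b → a * a + b * b + (2 * a + 2 * b + 2) ≡ suc a * suc a + suc b * suc b
  lem₂ = solve-∀

∑-* : ∀ {m n} (f : Fin m → ℕ) (g : Fin n → ℕ) → ∑ f * ∑ g ≡ ∑ (λ i → ∑ (λ j → f i * g j))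
∑-* f g = trans (sym (∑-*ʳ (∑ g) f)) (∑-cong (λ i → sym (∑-*ˡ (f i) g)))

∑-swap₂₂ : ∀ {m} (f : (b d t t′ : Fin m) → ℕ) →
  ∑ (λ b → ∑ (λ d → ∑ (λ t → ∑ (λ t′ → f b d t t′)))) ≡ ∑ (λ t → ∑ (λ t′ → ∑ (λ b → ∑ (λ d → f b d t t′))))
∑-swap₂₂ f = begin
  ∑ (λ b → ∑ (λ d → ∑ (λ t → ∑ (λ t′ → f b d t t′)))) ≡⟨ ∑-cong (λ b → ∑-swap (λ d t → ∑ (λ t′ → f b d t t′))) ⟩
  ∑ (λ b → ∑ (λ t → ∑ (λ d → ∑ (λ t′ → f b d t t′)))) ≡⟨ ∑-swap (λ b t → ∑ (λ d → ∑ (λ t′ → f b d t t′))) ⟩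
  ∑ (λ t → ∑ (λ b → ∑ (λ d → ∑ (λ t′ → f b d t t′)))) ≡⟨ ∑-cong (λ t → ∑-cong (λ b → ∑-swap (λ d t′ → f b d t t′))) ⟩
  ∑ (λ t → ∑ (λ b → ∑ (λ t′ → ∑ (λ d → f b d t t′)))) ≡⟨ ∑-cong (λ t → ∑-swap (λ b t′ → ∑ (λ d → f b d t t′))) ⟩
  ∑ (λ t → ∑ (λ t′ → ∑ (λ b → ∑ (λ d → f b d t t′)))) ∎
  where open ≡-Reasoning

*-cancel-square-≤ : ∀ {x z} → x * x ≤ z * z → x ≤ z
*-cancel-square-≤ {x} {z} le with x ≤? z
... | yes x≤z = x≤z
... | no x≰z = ⊥-elim (<⇒≱ (*-mono-< (≰⇒> x≰z) (≰⇒> x≰z)) le)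

-- The field of p elements

module PrimeField (n : ℕ) (pr : Prime (suc n)) where

  p : ℕ
  p = suc n

  F : Set
  F = Fin p

  abstract
    ι : ℕ → F
    ι k = fromℕ< (m%n<n k p)

    toℕ-ι : ∀ k → toℕ (ι k) ≡ k % p
    toℕ-ι k = toℕ-fromℕ< (m%n<n k p)

  ι-cong : ∀ {a b} → a % p ≡ b % p → ι a ≡ ι b
  ι-cong {a} {b} e = toℕ-injective (trans (toℕ-ι a) (trans e (sym (toℕ-ι b))))

  ι-injective : ∀ {a b} → ι a ≡ ι b → a % p ≡ b % p
  ι-injective {a} {b} e = trans (sym (toℕ-ι a)) (trans (cong toℕ e) (toℕ-ι b))

  ι-toℕ : ∀ x → ι (toℕ x) ≡ x
  ι-toℕ x = toℕ-injective (trans (toℕ-ι (toℕ x)) (m<n⇒m%n≡m (toℕ<n x)))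

  infixl 6 _⊕_
  infixl 7 _⊗_
  infix  8 ⊖_

  0F 1F : F
  0F = ι 0
  1F = ι 1

  abstract
    _⊕_ _⊗_ : F → F → F
    x ⊕ y = ι (toℕ x + toℕ y)
    x ⊗ y = ι (toℕ x * toℕ y)

    ⊖_ : F → F
    ⊖ x = ι (p ∸ toℕ x)

    ι-+ : ∀ a b → ι (a + b) ≡ ι a ⊕ ι b
    ι-+ a b = ι-cong {a + b} {toℕ (ι a) + toℕ (ι b)} (trans (%-distribˡ-+ a b p)
      (cong (_% p) (cong₂ _+_ (sym (toℕ-ι a)) (sym (toℕ-ι b)))))

    ι-* : ∀ a b → ι (a * b) ≡ ι a ⊗ ι b
    ι-* a b = ι-cong {a * b} {toℕ (ι a) * toℕ (ι b)} (trans (%-distribˡ-* a b p)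
      (cong (_% p) (cong₂ _*_ (sym (toℕ-ι a)) (sym (toℕ-ι b)))))

    ⊕-inverseʳ : ∀ x → x ⊕ ⊖ x ≡ 0F
    ⊕-inverseʳ x = trans (cong (_⊕ (⊖ x)) (sym (ι-toℕ x)))
      (trans (sym (ι-+ (toℕ x) (p ∸ toℕ x)))
        (ι-cong {toℕ x + (p ∸ toℕ x)} {0} (trans (cong (_% p) (m+[n∸m]≡n (<⇒≤ (toℕ<n x)))) (n%n≡0 p))))

  private
    -- `ι` is surjective and respects both operations, so each semiring law reduces to the same law
    -- in ℕ.
    lift₁ : {P : F → Set} → (∀ a → P (ι a)) → ∀ x → P x
    lift₁ {P} f x = subst P (ι-toℕ x) (f (toℕ x))

  ⊕-comm : ∀ x y → x ⊕ y ≡ y ⊕ x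
  ⊕-comm = lift₁ λ a → lift₁ λ b →
    trans (sym (ι-+ a b)) (trans (cong ι (+-comm a b)) (ι-+ b a))

  ⊗-comm : ∀ x y → x ⊗ y ≡ y ⊗ x
  ⊗-comm = lift₁ λ a → lift₁ λ b →
    trans (sym (ι-* a b)) (trans (cong ι (*-comm a b)) (ι-* b a))

  ⊕-assoc : ∀ x y z → (x ⊕ y) ⊕ z ≡ x ⊕ (y ⊕ z)
  ⊕-assoc = lift₁ λ a → lift₁ λ b → lift₁ λ c →
    trans (cong (_⊕ ι c) (sym (ι-+ a b))) (trans (sym (ι-+ (a + b) c))
    (trans (cong ι (+-assoc a b c)) (trans (ι-+ a (b + c)) (cong (ι a ⊕_) (ι-+ b c)))))

  ⊗-assoc : ∀ x y z → (x ⊗ y) ⊗ z ≡ x ⊗ (y ⊗ z)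
  ⊗-assoc = lift₁ λ a → lift₁ λ b → lift₁ λ c →
    trans (cong (_⊗ ι c) (sym (ι-* a b))) (trans (sym (ι-* (a * b) c))
    (trans (cong ι (*-assoc a b c)) (trans (ι-* a (b * c)) (cong (ι a ⊗_) (ι-* b c)))))

  ⊗-distribˡ-⊕ : ∀ x y z → x ⊗ (y ⊕ z) ≡ x ⊗ y ⊕ x ⊗ z
  ⊗-distribˡ-⊕ = lift₁ λ a → lift₁ λ b → lift₁ λ c →
    trans (cong (ι a ⊗_) (sym (ι-+ b c))) (trans (sym (ι-* a (b + c)))
    (trans (cong ι (*-distribˡ-+ a b c)) (trans (ι-+ (a * b) (a * c))
    (cong₂ _⊕_ (ι-* a b) (ι-* a c)))))

  ⊕-identityˡ : ∀ x → 0F ⊕ x ≡ x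
  ⊕-identityˡ = lift₁ λ a → sym (ι-+ 0 a)

  ⊗-identityˡ : ∀ x → 1F ⊗ x ≡ x
  ⊗-identityˡ = lift₁ λ a → trans (sym (ι-* 1 a)) (cong ι (*-identityˡ a))

  commutativeRing : CommutativeRing _ _
  commutativeRing = record
    { Carrier = F ; _≈_ = _≡_ ; _+_ = _⊕_ ; _*_ = _⊗_ ; -_ = ⊖_ ; 0# = 0F ; 1# = 1F
    ; isCommutativeRing = record
      { isRing = record
        { +-isAbelianGroup = record
          { isGroup = record
            { isMonoid = record
              { isSemigroup = record
                { isMagma = record { isEquivalence = isEquivalence ; ∙-cong = cong₂ _⊕_ }
                ; assoc = ⊕-assoc }
              ; identity = ⊕-identityˡ , λ x → trans (⊕-comm x 0F) (⊕-identityˡ x) }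
            ; inverse = (λ x → trans (⊕-comm (⊖ x) x) (⊕-inverseʳ x)) , ⊕-inverseʳ
            ; ⁻¹-cong = cong ⊖_ }
          ; comm = ⊕-comm }
        ; *-cong = cong₂ _⊗_
        ; *-assoc = ⊗-assoc
        ; *-identity = ⊗-identityˡ , λ x → trans (⊗-comm x 1F) (⊗-identityˡ x)
        ; distrib = ⊗-distribˡ-⊕ , λ x y z → trans (⊗-comm (y ⊕ z) x)
            (trans (⊗-distribˡ-⊕ x y z) (cong₂ _⊕_ (⊗-comm x y) (⊗-comm x z))) }
      ; *-comm = ⊗-comm } }

  open CommutativeRing commutativeRing using (commutativeSemiring)
    renaming (+-identityʳ to ⊕-identityʳ; *-identityʳ to ⊗-identityʳ; zeroˡ to ⊗-zeroˡ; zeroʳ to ⊗-zeroʳ; *-commutativeMonoid to ⊗-commutativeMonoid) public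

  open import Algebra.Properties.CommutativeSemiring.Exp commutativeSemiring
    using () renaming (_^_ to infixr 8 _↑_; ^-homo-* to ↑-homo; ^-assocʳ to ↑-assoc; ^-distrib-* to ↑-distrib) public

  ι-^ : ∀ a k → ι (a ^ k) ≡ ι a ↑ k
  ι-^ a zero    = refl
  ι-^ a (suc k) = trans (ι-* a (a ^ k)) (cong (ι a ⊗_) (ι-^ a k))

  1↑ : ∀ k → 1F ↑ k ≡ 1F
  1↑ zero    = refl
  1↑ (suc k) = trans (⊗-identityˡ _) (1↑ k)

  1<p : 1 < p
  1<p = nonTrivial⇒n>1 p {{prime⇒nonTrivial pr}}

  1≢0 : 1F ≢ 0F
  1≢0 e with trans (sym (m<n⇒m%n≡m 1<p)) (ι-injective e)
  ... | ()

  inverse : ∀ x → x ≢ 0F → ∃ λ y → y ⊗ x ≡ 1F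
  inverse x x≢0 with toℕ x in eq
  ... | zero = ⊥-elim (x≢0 (trans (sym (ι-toℕ x)) (cong ι eq)))
  ... | suc k with coprime-Bézout (prime⇒coprime pr (subst (_< p) eq (toℕ<n x)))
  ...   | Bézout.-+ a b e = ι b , (begin
            ι b ⊗ x           ≡⟨ cong (ι b ⊗_) (sym x≡) ⟩
            ι b ⊗ ι (suc k)   ≡⟨ ι-* b (suc k) ⟨
            ι (b * suc k)     ≡⟨ cong ι e ⟨
            ι (1 + a * p)     ≡⟨ ι-cong ([m+kn]%n≡m%n 1 a p) ⟩
            1F                ∎)
          where
          open ≡-Reasoning
          x≡ : ι (suc k) ≡ x
          x≡ = trans (cong ι (sym eq)) (ι-toℕ x)
  -- Here 1 + b x = a p, so b x is -1 in the field; n = p - 1 is -1 as well, hence n b is the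
  -- inverse.
  ...   | Bézout.+- a b e = ι (n * b) , (begin
            ι (n * b) ⊗ x                    ≡⟨ cong (ι (n * b) ⊗_) (sym x≡) ⟩
            ι (n * b) ⊗ ι (suc k)            ≡⟨ ι-* (n * b) (suc k) ⟨
            ι (n * b * suc k)                ≡⟨ ι-cong ([m+kn]%n≡m%n (n * b * suc k) a p) ⟨
            ι (n * b * suc k + a * p)        ≡⟨ cong (λ z → ι (n * b * suc k + z)) e ⟨
            ι (n * b * suc k + (1 + b * suc k)) ≡⟨ cong ι (collect n b (suc k)) ⟩
            ι (1 + b * suc k * p)            ≡⟨ ι-cong ([m+kn]%n≡m%n 1 (b * suc k) p) ⟩
            1F                               ∎)
          where
          open ≡-Reasoning
          x≡ : ι (suc k) ≡ x
          x≡ = trans (cong ι (sym eq)) (ι-toℕ x)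
          collect : ∀ n b k → n * b * k + (1 + b * k) ≡ 1 + b * k * suc n
          collect = solve-∀

  ⊗-cancelʳ : ∀ x y z → x ⊗ z ≡ y ⊗ z → x ≡ y ⊎ z ≡ 0F
  ⊗-cancelʳ x y z e with z ≟F 0F
  ... | yes z≡0 = inj₂ z≡0
  ... | no z≢0 with w , wz ← inverse z z≢0 = inj₁ (trans (sym (unit x)) (trans (cong (_⊗ w) e) (unit y)))
    where
    unit : ∀ x → x ⊗ z ⊗ w ≡ x
    unit x = trans (⊗-assoc x z w) (trans (cong (x ⊗_) (trans (⊗-comm z w) wz)) (⊗-identityʳ x))

  ∑-translate : ∀ (f : F → ℕ) s → ∑ (λ x → f (x ⊕ s)) ≡ ∑ f
  ∑-translate f s = ∑-permute f (permutation (_⊕ s) (_⊕ (⊖ s)) (lem₁ s) (lem₂ s))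
    where
    lem₁ : ∀ s x → x ⊕ ⊖ s ⊕ s ≡ x
    lem₁ s x = trans (⊕-assoc x (⊖ s) s) (trans (cong (x ⊕_) (trans (⊕-comm (⊖ s) s) (⊕-inverseʳ s))) (⊕-identityʳ x))
    lem₂ : ∀ s x → x ⊕ s ⊕ ⊖ s ≡ x
    lem₂ s x = trans (⊕-assoc x s (⊖ s)) (trans (cong (x ⊕_) (⊕-inverseʳ s)) (⊕-identityʳ x))

  dilation : ∀ s → s ≢ 0F → Permutation p p
  dilation s s≢0 = permutation (s ⊗_) (r ⊗_)
      (λ x → trans (sym (⊗-assoc s r x)) (trans (cong (_⊗ x) (trans (⊗-comm s r) rs)) (⊗-identityˡ x)))
      (λ x → trans (sym (⊗-assoc r s x)) (trans (cong (_⊗ x) rs) (⊗-identityˡ x)))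
    where
    r = proj₁ (inverse s s≢0)
    rs = proj₂ (inverse s s≢0)

  ∑-dilate : ∀ (f : F → ℕ) s → s ≢ 0F → ∑ (λ x → f (s ⊗ x)) ≡ ∑ f
  ∑-dilate f s s≢0 = ∑-permute f (dilation s s≢0)

  -- Horner form
  data Monic : ℕ → (F → F) → Set where
    one  : ∀ {f} → (∀ x → f x ≡ 1F) → Monic 0 f
    step : ∀ {k f g} c → Monic k g → (∀ x → f x ≡ x ⊗ g x ⊕ c) → Monic (suc k) f

  open import Algebra.Solver.Ring.NaturalCoefficients.Default commutativeSemiring
    using (solve; _:=_; _:+_; _:*_)

  -- f x − f r = (x − r) g x, with both sides moved so that no subtraction occurs.
  monic-factor : ∀ {k f} → Monic (suc k) f → ∀ r →
    Σ (F → F) λ g → Monic k g × (∀ x → f x ⊕ r ⊗ g x ≡ x ⊗ g x ⊕ f r)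
  monic-factor {f = f} (step {g = g} c (one g≡1) eq) r = g , one g≡1 , λ x →
    trans (cong₂ _⊕_ (trans (eq x) (cong (λ z → x ⊗ z ⊕ c) (g≡1 x))) (cong (r ⊗_) (g≡1 x)))
      (trans (solve 4 (λ x r c i → x :* i :+ c :+ r :* i := x :* i :+ (r :* i :+ c)) refl x r c 1F)
      (sym (cong₂ _⊕_ (cong (x ⊗_) (g≡1 x)) (trans (eq r) (cong (λ z → r ⊗ z ⊕ c) (g≡1 r))))))
  monic-factor {f = f} (step {g = g} c mg@(step _ _ _) eq) r with h , mh , eqh ← monic-factor mg r =
    (λ x → x ⊗ h x ⊕ g r) , step (g r) mh (λ _ → refl) , λ x →
      trans (cong (_⊕ r ⊗ (x ⊗ h x ⊕ g r)) (eq x))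
      (trans (solve 6 (λ x gx c r hx gr → x :* gx :+ c :+ r :* (x :* hx :+ gr)
                        := x :* (gx :+ r :* hx) :+ (r :* gr :+ c)) refl x (g x) c r (h x) (g r))
      (cong₂ _⊕_ (cong (x ⊗_) (eqh x)) (sym (eq r))))

  #roots : (F → F) → ℕ
  #roots f = ∑ (λ x → 𝟙 (f x ≟F 0F))

  #roots-monic : ∀ {k f} → Monic k f → #roots f ≤ k
  #roots-monic {f = f} (one f≡1) =
    ≤-reflexive (∑-zero (λ x → 𝟙-no (f x ≟F 0F) (λ e → 1≢0 (trans (sym (f≡1 x)) e))))
  #roots-monic {suc k} {f} m@(step _ _ _) with any? (λ x → f x ≟F 0F)
  ... | no none = ≤-trans (≤-reflexive (∑-zero (λ x → 𝟙-no (f x ≟F 0F) (λ e → none (x , e))))) z≤n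
  ... | yes (r , fr) with g , mg , eq ← monic-factor m r = begin
      ∑ (λ x → 𝟙 (f x ≟F 0F))                        ≤⟨ ∑-mono pointwise ⟩
      ∑ (λ x → 𝟙 (x ≟F r) + 𝟙 (g x ≟F 0F))           ≡⟨ ∑-+ (λ x → 𝟙 (x ≟F r)) _ ⟩
      ∑ (λ x → 𝟙 (x ≟F r)) + #roots g                ≤⟨ +-mono-≤ (≤-reflexive (∑-≟ r)) (#roots-monic mg) ⟩
      suc k                                            ∎
    where
    open ≤-Reasoning
    pointwise : ∀ x → 𝟙 (f x ≟F 0F) ≤ 𝟙 (x ≟F r) + 𝟙 (g x ≟F 0F)
    pointwise x with f x ≟F 0F
    ... | no _ = z≤n
    ... | yes fx with ⊗-cancelʳ r x (g x) (trans (sym (⊕-identityˡ _)) (trans (cong (_⊕ r ⊗ g x) (sym fx))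
                       (trans (eq x) (trans (cong (x ⊗ g x ⊕_) fr) (⊕-identityʳ _)))))
    ...   | inj₁ r≡x = ≤-trans (≤-reflexive (sym (𝟙-yes (x ≟F r) (sym r≡x)))) (m≤m+n _ _)
    ...   | inj₂ g≡0 = ≤-trans (≤-reflexive (sym (𝟙-yes (g x ≟F 0F) g≡0))) (m≤n+m _ _)

  open import Algebra.Properties.CommutativeMonoid.Sum ⊗-commutativeMonoid
    using () renaming (sum to ∏; sum-cong-≗ to ∏-cong; sum-permute to ∏-permute; ∑-distrib-+ to ∏-⊗; sum-replicate to ∏-replicate)

  0F≡fzero : 0F ≡ fzero
  0F≡fzero = toℕ-injective (toℕ-ι 0)

  0↑ : ∀ k → .{{NonZero k}} → 0F ↑ k ≡ 0F
  0↑ (suc k) = ⊗-zeroˡ _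

  ↑≡1⇒≢0 : ∀ k → .{{NonZero k}} → ∀ {x} → x ↑ k ≡ 1F → x ≢ 0F
  ↑≡1⇒≢0 k e refl = 1≢0 (trans (sym e) (0↑ k))

  ↑-∣ : ∀ {c k x} → c ∣ k → x ↑ c ≡ 1F → x ↑ k ≡ 1F
  ↑-∣ {c} {x = x} (divides q refl) e =
    trans (cong (x ↑_) (*-comm q c)) (trans (sym (↑-assoc x c q)) (trans (cong (_↑ q) e) (1↑ q)))

  ∏-≢0 : ∀ {k} (f : Fin k → F) → (∀ i → f i ≢ 0F) → ∏ f ≢ 0F
  ∏-≢0 {zero}  f f≢0 e = 1≢0 e
  ∏-≢0 {suc k} f f≢0 e with ⊗-cancelʳ (f fzero) 0F (∏ (f ∘ fsuc)) (trans e (sym (⊗-zeroˡ _)))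
  ... | inj₁ z = f≢0 fzero z
  ... | inj₂ z = ∏-≢0 (f ∘ fsuc) (f≢0 ∘ fsuc) z

  ⊗-≢0 : ∀ {x y} → x ≢ 0F → y ≢ 0F → x ⊗ y ≢ 0F
  ⊗-≢0 {x} {y} x≢0 y≢0 e with ⊗-cancelʳ x 0F y (trans e (sym (⊗-zeroˡ y)))
  ... | inj₁ z = x≢0 z
  ... | inj₂ z = y≢0 z

  -- Replacing 0 by 1 lets the product in `fermat` run over the whole field, which multiplication by
  -- s permutes, instead of over a separate type of units.
  nonzeroPart : F → F
  nonzeroPart fzero    = 1F
  nonzeroPart (fsuc i) = fsuc i

  suc≢0 : ∀ {i} → fsuc i ≢ 0F
  suc≢0 {i} e = lem (trans e 0F≡fzero)
    where
    lem : fsuc i ≢ fzero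
    lem ()

  nonzeroPart-≢0 : ∀ x → nonzeroPart x ≢ 0F
  nonzeroPart-≢0 fzero    = 1≢0
  nonzeroPart-≢0 (fsuc i) = suc≢0

  nonzeroPart-id : ∀ x → x ≢ 0F → nonzeroPart x ≡ x
  nonzeroPart-id fzero    x≢0 = ⊥-elim (x≢0 (sym 0F≡fzero))
  nonzeroPart-id (fsuc i) _   = refl

  fermat : ∀ s → s ≢ 0F → s ↑ n ≡ 1F
  fermat s s≢0 = conclude (⊗-cancelʳ (s ↑ n) 1F (∏ nonzeroPart) eq)
    where
    k : F → F
    k fzero    = 1F
    k (fsuc i) = s
    s⊗0 : s ⊗ fzero ≡ fzero
    s⊗0 = trans (cong (s ⊗_) (sym 0F≡fzero)) (trans (⊗-zeroʳ s) 0F≡fzero)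
    pointwise : ∀ x → nonzeroPart (s ⊗ x) ≡ k x ⊗ nonzeroPart x
    pointwise fzero    = trans (cong nonzeroPart s⊗0) (sym (⊗-identityˡ 1F))
    pointwise (fsuc i) = nonzeroPart-id _ (⊗-≢0 s≢0 suc≢0)
    ∏k : ∏ k ≡ s ↑ n
    ∏k = trans (⊗-identityˡ _) (∏-replicate n)
    eq : (s ↑ n) ⊗ ∏ nonzeroPart ≡ 1F ⊗ ∏ nonzeroPart
    eq = begin
      (s ↑ n) ⊗ ∏ nonzeroPart             ≡⟨ cong (_⊗ ∏ nonzeroPart) ∏k ⟨
      ∏ k ⊗ ∏ nonzeroPart                 ≡⟨ ∏-⊗ k nonzeroPart ⟨
      ∏ (λ x → k x ⊗ nonzeroPart x)       ≡⟨ ∏-cong pointwise ⟨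
      ∏ (λ x → nonzeroPart (s ⊗ x))       ≡⟨ ∏-permute nonzeroPart (dilation s s≢0) ⟨
      ∏ nonzeroPart                       ≡⟨ ⊗-identityˡ _ ⟨
      1F ⊗ ∏ nonzeroPart                  ∎
      where open ≡-Reasoning
    conclude : s ↑ n ≡ 1F ⊎ ∏ nonzeroPart ≡ 0F → s ↑ n ≡ 1F
    conclude (inj₁ e) = e
    conclude (inj₂ e) = ⊥-elim (∏-≢0 nonzeroPart nonzeroPart-≢0 e)

  -- Groups of roots of unity and their sizes

  pow-monic : ∀ k → Monic k (_↑ k)
  pow-monic zero    = one (λ _ → refl)
  pow-monic (suc k) = step 0F (pow-monic k) (λ x → sym (⊕-identityʳ _))

  ⊖-moveˡ : ∀ {x c} → x ≡ c → x ⊕ ⊖ c ≡ 0F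
  ⊖-moveˡ {c = c} refl = ⊕-inverseʳ c

  #power-roots : ∀ k → .{{NonZero k}} → ∀ c → ∑ (λ x → 𝟙 (x ↑ k ≟F c)) ≤ k
  #power-roots (suc k) c = ≤-trans
    (∑-mono (λ x → 𝟙-mono (x ↑ suc k ≟F c) (x ↑ suc k ⊕ ⊖ c ≟F 0F) ⊖-moveˡ))
    (#roots-monic (step (⊖ c) (pow-monic k) (λ _ → refl)))

  μ : ℕ → F → ℕ
  μ k x = 𝟙 (x ↑ k ≟F 1F)

  card : ℕ → ℕ
  card k = ∑ (μ k)

  card≤ : ∀ k → .{{NonZero k}} → card k ≤ k
  card≤ k = #power-roots k 1F

  card≥1 : ∀ k → 1 ≤ card k
  card≥1 k = ≤-trans (≤-reflexive (sym (𝟙-yes (1F ↑ k ≟F 1F) (1↑ k)))) (term≤∑ (μ k) 1F)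

  -- x ↦ xᴬ maps the units into μ_R, with fibres of size at most A.
  card≥ : ∀ A R → n ≡ A * R → R ≤ card R
  card≥ zero    R e = ⊥-elim (n≢0 e)
    where
    n≢0 : n ≢ 0
    n≢0 e′ = <⇒≢ (s≤s⁻¹ 1<p) (sym e′)
  card≥ A@(suc _) R e = *-cancelˡ-≤ A (subst (_≤ A * card R) e (s≤s⁻¹ (begin
    p                                                              ≡⟨ *-identityʳ p ⟨
    p * 1                                                          ≡⟨ ∑-const {p} 1 ⟨
    ∑ {p} (λ x → 1)                                                ≤⟨ ∑-mono pointwise ⟩
    ∑ (λ x → 𝟙 (x ≟F 0F) + ∑ (λ y → μ R y * 𝟙 (x ↑ A ≟F y)))       ≡⟨ ∑-+ (λ x → 𝟙 (x ≟F 0F)) _ ⟩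
    ∑ (λ x → 𝟙 (x ≟F 0F)) + ∑ (λ x → ∑ (λ y → μ R y * 𝟙 (x ↑ A ≟F y)))
      ≡⟨ cong₂ _+_ (∑-≟ 0F) (∑-swap (λ x y → μ R y * 𝟙 (x ↑ A ≟F y))) ⟩
    1 + ∑ (λ y → ∑ (λ x → μ R y * 𝟙 (x ↑ A ≟F y)))
      ≡⟨ cong suc (∑-cong (λ y → ∑-*ˡ (μ R y) (λ x → 𝟙 (x ↑ A ≟F y)))) ⟩
    1 + ∑ (λ y → μ R y * ∑ (λ x → 𝟙 (x ↑ A ≟F y)))
      ≤⟨ s≤s (∑-mono (λ y → *-monoʳ-≤ (μ R y) (#power-roots A y))) ⟩
    1 + ∑ (λ y → μ R y * A)                                        ≡⟨ cong suc (∑-*ʳ A (μ R)) ⟩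
    1 + card R * A                                                 ≡⟨ cong suc (*-comm (card R) A) ⟩
    1 + A * card R                                                 ∎)))
    where
    open ≤-Reasoning
    pointwise : ∀ x → 1 ≤ 𝟙 (x ≟F 0F) + ∑ (λ y → μ R y * 𝟙 (x ↑ A ≟F y))
    pointwise x with x ≟F 0F
    ... | yes _ = s≤s z≤n
    ... | no x≢0 = ≤-trans
      (≤-reflexive (sym (cong₂ _*_ (𝟙-yes ((x ↑ A) ↑ R ≟F 1F) xAR) (𝟙-yes (x ↑ A ≟F x ↑ A) refl))))
      (term≤∑ (λ y → μ R y * 𝟙 (x ↑ A ≟F y)) (x ↑ A))
      where
      xAR : (x ↑ A) ↑ R ≡ 1F
      xAR = trans (↑-assoc x A R) (trans (cong (x ↑_) (sym e)) (fermat x x≢0))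

  μ≤1 : ∀ k x → μ k x ≤ 1
  μ≤1 k x = 𝟙≤1 (x ↑ k ≟F 1F)

  μ-⊗ : ∀ k {s} → s ↑ k ≡ 1F → ∀ x → μ k (s ⊗ x) ≡ μ k x
  μ-⊗ k {s} e x = cong (λ z → 𝟙 (z ≟F 1F))
    (trans (↑-distrib s x k) (trans (cong (_⊗ x ↑ k) e) (⊗-identityˡ _)))

  -- Incidences with lines and their variance

  ∑-affine : ∀ (f : F → ℕ) s d → s ≢ 0F → ∑ (λ b → f (d ⊕ b ⊗ s)) ≡ ∑ f
  ∑-affine f s d s≢0 = trans
    (∑-cong (λ b → cong f (trans (⊕-comm d (b ⊗ s)) (cong (_⊕ d) (⊗-comm b s)))))
    (trans (∑-dilate (λ x → f (x ⊕ d)) s s≢0) (∑-translate f d))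

  -- Second moment of the number of points of μ_R × μ_c on the lines X = d + b t.
  module Lines (R c : ℕ) where

    C : ℕ
    C = card R * card c

    incidences : F → F → ℕ
    incidences b d = ∑ (λ t → μ R t * μ c (d ⊕ b ⊗ t))

    -- Each of the C points lies on exactly one line of each slope b.
    firstMoment : ∑ (λ b → ∑ (λ d → incidences b d)) ≡ p * C
    firstMoment = trans (∑-cong inner) (∑-const C)
      where
      open ≡-Reasoning
      inner : ∀ b → ∑ (λ d → incidences b d) ≡ C
      inner b = begin
        ∑ (λ d → ∑ (λ t → μ R t * μ c (d ⊕ b ⊗ t))) ≡⟨ ∑-swap (λ d t → μ R t * μ c (d ⊕ b ⊗ t)) ⟩
        ∑ (λ t → ∑ (λ d → μ R t * μ c (d ⊕ b ⊗ t))) ≡⟨ ∑-cong (λ t → ∑-*ˡ (μ R t) (λ d → μ c (d ⊕ b ⊗ t))) ⟩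
        ∑ (λ t → μ R t * ∑ (λ d → μ c (d ⊕ b ⊗ t))) ≡⟨ ∑-cong (λ t → cong (μ R t *_) (∑-translate (μ c) (b ⊗ t))) ⟩
        ∑ (λ t → μ R t * card c)                    ≡⟨ ∑-*ʳ (card c) (μ R) ⟩
        C                                           ∎

    correlation : F → F → ℕ
    correlation t t′ = ∑ (λ b → ∑ (λ d → μ c (d ⊕ b ⊗ t) * μ c (d ⊕ b ⊗ t′)))

    -- For t ≠ t′ the map (b , d) ↦ (d + b t , d + b t′) is a bijection of the plane, so the two
    -- memberships in μ_c are independent. It is split into a translation of d and an affine
    -- substitution for b with factor s = t′ - t.
    correlation-distinct : ∀ {t t′} → t ≢ t′ → correlation t t′ ≡ card c * card c
    correlation-distinct {t} {t′} t≢t′ = begin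
      ∑ (λ b → ∑ (λ d → μ c (d ⊕ b ⊗ t) * μ c (d ⊕ b ⊗ t′)))
        ≡⟨ ∑-cong (λ b → ∑-cong (λ d → cong (λ z → μ c (d ⊕ b ⊗ t) * μ c z) (shift d b))) ⟩
      ∑ (λ b → ∑ (λ d → μ c (d ⊕ b ⊗ t) * μ c (d ⊕ b ⊗ t ⊕ b ⊗ s)))
        ≡⟨ ∑-cong (λ b → ∑-translate (λ d → μ c d * μ c (d ⊕ b ⊗ s)) (b ⊗ t)) ⟩
      ∑ (λ b → ∑ (λ d → μ c d * μ c (d ⊕ b ⊗ s))) ≡⟨ ∑-swap (λ b d → μ c d * μ c (d ⊕ b ⊗ s)) ⟩
      ∑ (λ d → ∑ (λ b → μ c d * μ c (d ⊕ b ⊗ s))) ≡⟨ ∑-cong (λ d → ∑-*ˡ (μ c d) (λ b → μ c (d ⊕ b ⊗ s))) ⟩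
      ∑ (λ d → μ c d * ∑ (λ b → μ c (d ⊕ b ⊗ s))) ≡⟨ ∑-cong (λ d → cong (μ c d *_) (∑-affine (μ c) s d s≢0)) ⟩
      ∑ (λ d → μ c d * card c)                    ≡⟨ ∑-*ʳ (card c) (μ c) ⟩
      card c * card c                             ∎
      where
      open ≡-Reasoning
      s : F
      s = t′ ⊕ ⊖ t
      t⊕s : t ⊕ s ≡ t′
      t⊕s = begin
        t ⊕ (t′ ⊕ ⊖ t)  ≡⟨ ⊕-comm t s ⟩
        t′ ⊕ ⊖ t ⊕ t    ≡⟨ ⊕-assoc t′ (⊖ t) t ⟩
        t′ ⊕ (⊖ t ⊕ t)  ≡⟨ cong (t′ ⊕_) (trans (⊕-comm (⊖ t) t) (⊕-inverseʳ t)) ⟩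
        t′ ⊕ 0F         ≡⟨ ⊕-identityʳ t′ ⟩
        t′              ∎
      s≢0 : s ≢ 0F
      s≢0 e = t≢t′ (trans (sym (⊕-identityʳ t)) (trans (cong (t ⊕_) (sym e)) t⊕s))
      shift : ∀ d b → d ⊕ b ⊗ t′ ≡ d ⊕ b ⊗ t ⊕ b ⊗ s
      shift d b = trans (cong (λ z → d ⊕ b ⊗ z) (sym t⊕s))
        (trans (cong (d ⊕_) (⊗-distribˡ-⊕ b t s)) (sym (⊕-assoc d (b ⊗ t) (b ⊗ s))))

    correlation≤ : ∀ t t′ → correlation t t′ ≤ 𝟙 (t′ ≟F t) * (p * card c) + card c * card c
    correlation≤ t t′ with t′ ≟F t
    ... | no t′≢t = ≤-reflexive (correlation-distinct (t′≢t ∘ sym))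
    ... | yes refl = begin
      ∑ (λ b → ∑ (λ d → μ c (d ⊕ b ⊗ t) * μ c (d ⊕ b ⊗ t)))
        ≤⟨ ∑-mono (λ b → ∑-mono (λ d → ≤-trans (*-monoʳ-≤ (μ c (d ⊕ b ⊗ t)) (μ≤1 c _)) (≤-reflexive (*-identityʳ _)))) ⟩
      ∑ (λ b → ∑ (λ d → μ c (d ⊕ b ⊗ t)))   ≡⟨ ∑-cong (λ b → ∑-translate (μ c) (b ⊗ t)) ⟩
      ∑ {p} (λ b → card c)                  ≡⟨ ∑-const (card c) ⟩
      p * card c                            ≡⟨ *-identityˡ _ ⟨
      1 * (p * card c)                      ≤⟨ m≤m+n _ _ ⟩
      1 * (p * card c) + card c * card c    ∎
      where open ≤-Reasoning

    secondMoment : ∑ (λ b → ∑ (λ d → incidences b d * incidences b d)) ≤ p * C + C * C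
    secondMoment = begin
      ∑ (λ b → ∑ (λ d → incidences b d * incidences b d))
        ≡⟨ ∑-cong (λ b → ∑-cong (λ d → ∑-* (λ t → μ R t * μ c (d ⊕ b ⊗ t)) (λ t → μ R t * μ c (d ⊕ b ⊗ t)))) ⟩
      ∑ (λ b → ∑ (λ d → ∑ (λ t → ∑ (λ t′ → (μ R t * μ c (d ⊕ b ⊗ t)) * (μ R t′ * μ c (d ⊕ b ⊗ t′))))))
        ≡⟨ ∑-swap₂₂ (λ b d t t′ → (μ R t * μ c (d ⊕ b ⊗ t)) * (μ R t′ * μ c (d ⊕ b ⊗ t′))) ⟩
      ∑ (λ t → ∑ (λ t′ → ∑ (λ b → ∑ (λ d → (μ R t * μ c (d ⊕ b ⊗ t)) * (μ R t′ * μ c (d ⊕ b ⊗ t′))))))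
        ≡⟨ ∑-cong (λ t → ∑-cong (λ t′ → factor t t′)) ⟩
      ∑ (λ t → ∑ (λ t′ → μ R t * μ R t′ * correlation t t′))
        ≤⟨ ∑-mono (λ t → ∑-mono (λ t′ → *-monoʳ-≤ (μ R t * μ R t′) (correlation≤ t t′))) ⟩
      ∑ (λ t → ∑ (λ t′ → μ R t * μ R t′ * (𝟙 (t′ ≟F t) * (p * card c) + card c * card c)))
        ≤⟨ ∑-mono (λ t → ∑-mono (λ t′ → split (μ R t) (μ R t′) (𝟙 (t′ ≟F t)) (μ≤1 R t′))) ⟩
      ∑ (λ t → ∑ (λ t′ → μ R t * (p * card c) * 𝟙 (t′ ≟F t) + μ R t * (card c * card c) * μ R t′))
        ≡⟨ ∑-cong (λ t → trans (∑-+ (λ t′ → μ R t * (p * card c) * 𝟙 (t′ ≟F t)) _)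
             (cong₂ _+_ (trans (∑-*ˡ (μ R t * (p * card c)) (λ t′ → 𝟙 (t′ ≟F t)))
                           (trans (cong (μ R t * (p * card c) *_) (∑-≟ t)) (*-identityʳ _)))
                        (∑-*ˡ (μ R t * (card c * card c)) (μ R)))) ⟩
      ∑ (λ t → μ R t * (p * card c) + μ R t * (card c * card c) * card R)
        ≡⟨ ∑-cong (λ t → collect (μ R t) (p * card c) (card c * card c) (card R)) ⟩
      ∑ (λ t → μ R t * (p * card c + card c * card c * card R))
        ≡⟨ ∑-*ʳ (p * card c + card c * card c * card R) (μ R) ⟩
      card R * (p * card c + card c * card c * card R)
        ≡⟨ final (card R) p (card c) ⟩
      p * C + C * C ∎
      where
      open ≤-Reasoning
      regroup : ∀ x y z w → (x * y) * (z * w) ≡ x * z * (y * w)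
      regroup = solve-∀
      factor : ∀ t t′ → ∑ (λ b → ∑ (λ d → (μ R t * μ c (d ⊕ b ⊗ t)) * (μ R t′ * μ c (d ⊕ b ⊗ t′))))
                        ≡ μ R t * μ R t′ * correlation t t′
      factor t t′ = trans (∑-cong (λ b → trans
          (∑-cong (λ d → regroup (μ R t) (μ c (d ⊕ b ⊗ t)) (μ R t′) (μ c (d ⊕ b ⊗ t′))))
          (∑-*ˡ (μ R t * μ R t′) (λ d → μ c (d ⊕ b ⊗ t) * μ c (d ⊕ b ⊗ t′)))))
        (∑-*ˡ (μ R t * μ R t′) (λ b → ∑ (λ d → μ c (d ⊕ b ⊗ t) * μ c (d ⊕ b ⊗ t′))))
      split : ∀ x y e → y ≤ 1 → x * y * (e * (p * card c) + card c * card c)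
              ≤ x * (p * card c) * e + x * (card c * card c) * y
      split x y e y≤1 = begin
        x * y * (e * (p * card c) + card c * card c)                 ≡⟨ expand x y e (p * card c) (card c * card c) ⟩
        x * (p * card c) * e * y + x * (card c * card c) * y         ≤⟨ +-monoˡ-≤ _ (*-monoʳ-≤ (x * (p * card c) * e) y≤1) ⟩
        x * (p * card c) * e * 1 + x * (card c * card c) * y         ≡⟨ cong (_+ x * (card c * card c) * y) (*-identityʳ _) ⟩
        x * (p * card c) * e + x * (card c * card c) * y             ∎
        where
        expand : ∀ x y e P Q → x * y * (e * P + Q) ≡ x * P * e * y + x * Q * y
        expand = solve-∀
      collect : ∀ x P Q r → x * P + x * Q * r ≡ x * (P + Q * r)
      collect = solve-∀
      final : ∀ r p k → r * (p * k + k * k * r) ≡ p * (r * k) + r * k * (r * k)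
      final = solve-∀

    -- The mean of `incidences` over the p² lines is C / p; scaling by p avoids fractions.
    deviation : F → F → ℕ
    deviation b d = ∣ p * incidences b d - C ∣ * ∣ p * incidences b d - C ∣

    -- With N for `incidences`, Σ (p N - C)² = p² Σ N² - 2 p C Σ N + p² C², and inserting the two
    -- moments leaves p³ C. The cross term is added to both sides instead of being subtracted.
    variance : ∑ (λ b → ∑ (λ d → deviation b d)) ≤ p * p * p * C
    variance = +-cancelʳ-≤ (2 * (p * C) * (p * C)) _ _ (begin
      ∑ (λ b → ∑ (λ d → deviation b d)) + 2 * (p * C) * (p * C)
        ≡⟨ cong (λ z → ∑ (λ b → ∑ (λ d → deviation b d)) + 2 * (p * C) * z) firstMoment ⟨
      ∑ (λ b → ∑ (λ d → deviation b d)) + 2 * (p * C) * ∑ (λ b → ∑ (λ d → incidences b d))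
        ≡⟨ cong (∑ (λ b → ∑ (λ d → deviation b d)) +_)
             (sym (trans (∑-cong (λ b → ∑-*ˡ (2 * (p * C)) (incidences b))) (∑-*ˡ (2 * (p * C)) (λ b → ∑ (incidences b))))) ⟩
      ∑ (λ b → ∑ (λ d → deviation b d)) + ∑ (λ b → ∑ (λ d → 2 * (p * C) * incidences b d))
        ≡⟨ ∑∑-+ deviation (λ b d → 2 * (p * C) * incidences b d) ⟩
      ∑ (λ b → ∑ (λ d → deviation b d + 2 * (p * C) * incidences b d))
        ≡⟨ ∑-cong (λ b → ∑-cong (λ d → pointwise (incidences b d))) ⟩
      ∑ (λ b → ∑ (λ d → p * p * (incidences b d * incidences b d) + C * C))
        ≡⟨ ∑∑-+ (λ b d → p * p * (incidences b d * incidences b d)) (λ b d → C * C) ⟨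
      ∑ (λ b → ∑ (λ d → p * p * (incidences b d * incidences b d))) + ∑ {p} (λ b → ∑ {p} (λ d → C * C))
        ≡⟨ cong₂ _+_
             (trans (∑-cong (λ b → ∑-*ˡ (p * p) (λ d → incidences b d * incidences b d)))
                    (∑-*ˡ (p * p) (λ b → ∑ (λ d → incidences b d * incidences b d))))
             (trans (∑-cong (λ b → ∑-const {p} (C * C))) (∑-const {p} (p * (C * C)))) ⟩
      p * p * ∑ (λ b → ∑ (λ d → incidences b d * incidences b d)) + p * (p * (C * C))
        ≤⟨ +-monoˡ-≤ (p * (p * (C * C))) (*-monoʳ-≤ (p * p) secondMoment) ⟩
      p * p * (p * C + C * C) + p * (p * (C * C))
        ≡⟨ final p C ⟩
      p * p * p * C + 2 * (p * C) * (p * C) ∎)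
      where
      open ≤-Reasoning
      ∑∑-+ : ∀ (f g : F → F → ℕ) → ∑ (λ b → ∑ (f b)) + ∑ (λ b → ∑ (g b)) ≡ ∑ (λ b → ∑ (λ d → f b d + g b d))
      ∑∑-+ f g = sym (trans (∑-cong (λ b → ∑-+ (f b) (g b))) (∑-+ (λ b → ∑ (f b)) (λ b → ∑ (g b))))
      assemble : ∀ p i C → 2 * (p * C) * i ≡ 2 * (p * i * C)
      assemble = solve-∀
      rearrange : ∀ p i C → p * i * (p * i) + C * C ≡ p * p * (i * i) + C * C
      rearrange = solve-∀
      pointwise : ∀ i → ∣ p * i - C ∣ * ∣ p * i - C ∣ + 2 * (p * C) * i ≡ p * p * (i * i) + C * C
      pointwise i = trans (cong (∣ p * i - C ∣ * ∣ p * i - C ∣ +_) (assemble p i C))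
        (trans (∣-∣-square (p * i) C) (rearrange p i C))
      final : ∀ p C → p * p * (p * C + C * C) + p * (p * (C * C)) ≡ p * p * p * C + 2 * (p * C) * (p * C)
      final = solve-∀

  -- The number of points on the line X = 1 + a t. Putting x = 1 + a t, each of them is a
  -- representation a = (x - 1) / t.
  #pairs : ℕ → ℕ → F → ℕ
  #pairs R c a = ∑ (λ t → μ R t * μ c (1F ⊕ a ⊗ t))

  -- The lines X = d + (a y) t with y ∈ μ_R and d ∈ μ_c all contain the same number of points,
  -- by rescaling t and X.
  #pairs-deviation : ∀ R c → .{{NonZero R}} → c ∣ R → ∀ a → a ≢ 0F →
    ∣ p * #pairs R c a - card R * card c ∣ * ∣ p * #pairs R c a - card R * card c ∣ ≤ p * p * p
  #pairs-deviation R c c∣R a a≢0 = *-cancelʳ-≤ _ _ C {{>-nonZero C>0}} (begin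
      D * C                                                       ≡⟨ *-comm D C ⟩
      card R * card c * D                                         ≡⟨ *-assoc (card R) (card c) D ⟩
      card R * (card c * D)                                       ≡⟨ ∑-*ʳ (card c * D) (μ R) ⟨
      ∑ (λ y → μ R y * (card c * D))                              ≡⟨ ∑-cong (λ y → cong (μ R y *_) (∑-*ʳ D (μ c))) ⟨
      ∑ (λ y → μ R y * ∑ (λ d → μ c d * D))                       ≡⟨ ∑-cong (λ y → ∑-*ˡ (μ R y) (λ d → μ c d * D)) ⟨
      ∑ (λ y → ∑ (λ d → μ R y * (μ c d * D)))                     ≤⟨ ∑-mono (λ y → ∑-mono (λ d → pointwise y d)) ⟩
      ∑ (λ y → ∑ (λ d → deviation (a ⊗ y) d))                     ≡⟨ ∑-dilate (λ b → ∑ (deviation b)) a a≢0 ⟩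
      ∑ (λ b → ∑ (λ d → deviation b d))                           ≤⟨ variance ⟩
      p * p * p * C                                               ∎)
    where
    open Lines R c
    open ≤-Reasoning
    D = ∣ p * #pairs R c a - C ∣ * ∣ p * #pairs R c a - C ∣
    C>0 : 0 < C
    C>0 = *-mono-≤ (card≥1 R) (card≥1 c)
    line : ∀ y d → y ↑ R ≡ 1F → d ↑ c ≡ 1F → incidences (a ⊗ y) d ≡ #pairs R c a
    line y d yR dc = trans (sym (∑-dilate (λ t → μ R t * μ c (d ⊕ a ⊗ y ⊗ t)) s (↑≡1⇒≢0 R sR)))
      (∑-cong (λ t → cong₂ _*_ (μ-⊗ R sR t) (trans (cong (μ c) (rescale t)) (μ-⊗ c dc (1F ⊕ a ⊗ t)))))
      where
      y≢0 = ↑≡1⇒≢0 R yR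
      y′ = proj₁ (inverse y y≢0)
      y′y = proj₂ (inverse y y≢0)
      -- Replacing t by s t turns d + a y t into d (1 + a t). For s to lie in μ_R, d must lie there,
      -- which is what `c ∣ R` provides.
      s = d ⊗ y′
      y′R : y′ ↑ R ≡ 1F
      y′R = trans (sym (⊗-identityʳ _)) (trans (cong (y′ ↑ R ⊗_) (sym yR))
        (trans (sym (↑-distrib y′ y R)) (trans (cong (_↑ R) y′y) (1↑ R))))
      sR : s ↑ R ≡ 1F
      sR = trans (↑-distrib d y′ R) (trans (cong₂ _⊗_ (↑-∣ c∣R dc) y′R) (⊗-identityˡ 1F))
      rescale : ∀ t → d ⊕ a ⊗ y ⊗ (s ⊗ t) ≡ d ⊗ (1F ⊕ a ⊗ t)
      rescale t = trans (solve 5 (λ d a y y′ t → d :+ a :* y :* (d :* y′ :* t) := d :+ d :* ((y′ :* y) :* (a :* t))) refl d a y y′ t)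
        (trans (cong₂ (λ u v → u ⊕ d ⊗ v) (sym (⊗-identityʳ d)) (trans (cong (_⊗ (a ⊗ t)) y′y) (⊗-identityˡ _)))
          (sym (⊗-distribˡ-⊕ d 1F (a ⊗ t))))
    pointwise : ∀ y d → μ R y * (μ c d * D) ≤ deviation (a ⊗ y) d
    pointwise y d with y ↑ R ≟F 1F | d ↑ c ≟F 1F
    ... | no _   | _      = z≤n
    ... | yes _  | no _   = z≤n
    ... | yes yR | yes dc = ≤-reflexive (trans (trans (*-identityˡ (1 * D)) (*-identityˡ D))
        (cong (λ N → ∣ p * N - C ∣ * ∣ p * N - C ∣) (sym (line y d yR dc))))

  -- Z is an integer standing for p^(3/2), the size of the error term.
  module _ (Z : ℕ) (p³≤Z² : p * p * p ≤ Z * Z) where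

    #pairs-close : ∀ R c → .{{NonZero R}} → c ∣ R → ∀ a → a ≢ 0F →
      ∣ p * #pairs R c a - card R * card c ∣ ≤ Z
    #pairs-close R c c∣R a a≢0 = *-cancel-square-≤ (≤-trans (#pairs-deviation R c c∣R a a≢0) p³≤Z²)

    #pairs-upper : ∀ R c → .{{NonZero R}} → c ∣ R → ∀ a → a ≢ 0F →
      p * #pairs R c a ≤ card R * card c + Z
    #pairs-upper R c c∣R a a≢0 = ≤-trans (m≤n+∣m-n∣ _ (card R * card c)) (+-monoʳ-≤ _ (#pairs-close R c c∣R a a≢0))

    #pairs-lower : ∀ R c → .{{NonZero R}} → c ∣ R → ∀ a → a ≢ 0F →
      card R * card c ≤ p * #pairs R c a + Z
    #pairs-lower R c c∣R a a≢0 = ≤-trans (m≤n+∣n-m∣ _ (p * #pairs R c a)) (+-monoʳ-≤ _ (#pairs-close R c c∣R a a≢0))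

    module _ (A R B : ℕ) .{{_ : NonZero R}} .{{_ : NonZero B}} (n≡AR : n ≡ A * R) (a : F) (a≢0 : a ≢ 0F) where

      -- Meant for c = R / ℓ with ℓ a prime factor of R, where ℓ ≥ B: the main term R c is then at
      -- most a fraction 1/B of R².
      Small : ℕ → Set
      Small c = c ∣ R × c * B ≤ R × NonZero c

      #pairs-list : List ℕ → ℕ
      #pairs-list []       = 0
      #pairs-list (c ∷ cs) = #pairs R c a + #pairs-list cs

      #pairs-list-upper : ∀ cs → All Small cs → B * (p * #pairs-list cs) ≤ length cs * (R * R + B * Z)
      #pairs-list-upper []       []                          = ≤-reflexive (trans (cong (B *_) (*-zeroʳ p)) (*-zeroʳ B))
      #pairs-list-upper (c ∷ cs) ((c∣R , cB≤R , c≢0) ∷ small) = begin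
        B * (p * (#pairs R c a + #pairs-list cs))              ≡⟨ distr B p (#pairs R c a) (#pairs-list cs) ⟩
        B * (p * #pairs R c a) + B * (p * #pairs-list cs)      ≤⟨ +-mono-≤ one-term (#pairs-list-upper cs small) ⟩
        (R * R + B * Z) + length cs * (R * R + B * Z)          ∎
        where
        open ≤-Reasoning
        distr : ∀ B p x y → B * (p * (x + y)) ≡ B * (p * x) + B * (p * y)
        distr = solve-∀
        shuffle : ∀ B r c Z → B * (r * c + Z) ≡ r * (c * B) + B * Z
        shuffle = solve-∀
        one-term : B * (p * #pairs R c a) ≤ R * R + B * Z
        one-term = begin
          B * (p * #pairs R c a)        ≤⟨ *-monoʳ-≤ B (#pairs-upper R c c∣R a a≢0) ⟩
          B * (card R * card c + Z)     ≤⟨ *-monoʳ-≤ B (+-monoˡ-≤ Z (*-mono-≤ (card≤ R) (card≤ c {{c≢0}}))) ⟩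
          B * (R * c + Z)               ≡⟨ shuffle B R c Z ⟩
          R * (c * B) + B * Z           ≤⟨ +-monoˡ-≤ (B * Z) (*-monoʳ-≤ R cB≤R) ⟩
          R * R + B * Z                 ∎

      -- Otherwise every pair counted by #pairs R R a is counted by #pairs R c a for some c in cs.
      exists-avoiding : ∀ cs → All Small cs → 2 * length cs ≤ B → 2 * suc (length cs) * Z < R * R →
        ∃ λ t → t ↑ R ≡ 1F × (1F ⊕ a ⊗ t) ↑ R ≡ 1F × All (λ c → (1F ⊕ a ⊗ t) ↑ c ≢ 1F) cs
      exists-avoiding cs small len≤ Z< with any? (λ t → t ↑ R ≟F 1F ×-dec (1F ⊕ a ⊗ t) ↑ R ≟F 1F
                                                 ×-dec all? (λ c → ¬? ((1F ⊕ a ⊗ t) ↑ c ≟F 1F)) cs)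
      ... | yes found = found
      ... | no none = ⊥-elim (<⇒≱ Z< (*-cancelˡ-≤ B (+-cancelˡ-≤ (B * (R * R)) _ _ main)))
        where
        open ≤-Reasoning
        ℓ = length cs
        count : F → List ℕ → ℕ
        count x []        = 0
        count x (c ∷ cs′) = μ c x + count x cs′
        covered : ∀ t cs′ → ¬ All (λ c → (1F ⊕ a ⊗ t) ↑ c ≢ 1F) cs′ → 1 ≤ count (1F ⊕ a ⊗ t) cs′
        covered t []        ¬all = ⊥-elim (¬all [])
        covered t (c ∷ cs′) ¬all with (1F ⊕ a ⊗ t) ↑ c ≟F 1F
        ... | yes _ = s≤s z≤n
        ... | no ≢1 = covered t cs′ (λ al → ¬all (≢1 ∷ al))
        pointwise : ∀ t → μ R t * μ R (1F ⊕ a ⊗ t) ≤ μ R t * count (1F ⊕ a ⊗ t) cs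
        pointwise t with t ↑ R ≟F 1F | (1F ⊕ a ⊗ t) ↑ R ≟F 1F
        ... | no _   | _      = z≤n
        ... | yes _  | no _   = z≤n
        ... | yes tR | yes xR = ≤-trans (covered t cs (λ al → none (t , tR , xR , al))) (≤-reflexive (sym (*-identityˡ _)))
        total : ∀ cs′ → ∑ (λ t → μ R t * count (1F ⊕ a ⊗ t) cs′) ≡ #pairs-list cs′
        total []        = ∑-zero (λ t → *-zeroʳ (μ R t))
        total (c ∷ cs′) = trans (∑-cong (λ t → *-distribˡ-+ (μ R t) (μ c (1F ⊕ a ⊗ t)) (count (1F ⊕ a ⊗ t) cs′)))
          (trans (∑-+ (λ t → μ R t * μ c (1F ⊕ a ⊗ t)) _) (cong (#pairs R c a +_) (total cs′)))
        R²≤ : R * R ≤ p * #pairs-list cs + Z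
        R²≤ = begin
          R * R                        ≤⟨ *-mono-≤ (card≥ A R n≡AR) (card≥ A R n≡AR) ⟩
          card R * card R              ≤⟨ #pairs-lower R R ∣-refl a a≢0 ⟩
          p * #pairs R R a + Z         ≤⟨ +-monoˡ-≤ Z (*-monoʳ-≤ p (≤-trans (∑-mono pointwise) (≤-reflexive (total cs)))) ⟩
          p * #pairs-list cs + Z       ∎
        alg₁ : ∀ B x Z → 2 * (B * (x + Z)) ≡ 2 * (B * x) + 2 * B * Z
        alg₁ = solve-∀
        alg₂ : ∀ l S B Z → 2 * (l * (S + B * Z)) + 2 * B * Z ≡ 2 * l * S + B * (2 * suc l * Z)
        alg₂ = solve-∀
        double : ∀ x → x + x ≡ 2 * x
        double = solve-∀
        -- Everything is multiplied by 2 B. The main terms of the divisors in `cs` add up to at most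
        -- ℓ R² / B ≤ R² / 2, so the other half of R² would have to come from ℓ + 1 error terms Z.
        main : B * (R * R) + B * (R * R) ≤ B * (R * R) + B * (2 * suc ℓ * Z)
        main = begin
          B * (R * R) + B * (R * R)                     ≡⟨ double (B * (R * R)) ⟩
          2 * (B * (R * R))                             ≤⟨ *-monoʳ-≤ 2 (*-monoʳ-≤ B R²≤) ⟩
          2 * (B * (p * #pairs-list cs + Z))            ≡⟨ alg₁ B (p * #pairs-list cs) Z ⟩
          2 * (B * (p * #pairs-list cs)) + 2 * B * Z    ≤⟨ +-monoˡ-≤ (2 * B * Z) (*-monoʳ-≤ 2 (#pairs-list-upper cs small)) ⟩
          2 * (ℓ * (R * R + B * Z)) + 2 * B * Z         ≡⟨ alg₂ ℓ (R * R) B Z ⟩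
          2 * ℓ * (R * R) + B * (2 * suc ℓ * Z)         ≤⟨ +-monoˡ-≤ (B * (2 * suc ℓ * Z)) (*-monoˡ-≤ (R * R) len≤) ⟩
          B * (R * R) + B * (2 * suc ℓ * Z)             ∎

  -- Powers of an element of exact order R

  ↑-gcd : ∀ x i j → x ↑ i ≡ 1F → x ↑ j ≡ 1F → x ↑ gcd i j ≡ 1F
  ↑-gcd x i j xi xj = go (Bézout.identity (gcd-GCD i j))
    where
    combine : ∀ g u v i j → x ↑ i ≡ 1F → x ↑ j ≡ 1F → g + v * j ≡ u * i → x ↑ g ≡ 1F
    combine g u v i j xi xj e = begin
      x ↑ g                   ≡⟨ ⊗-identityʳ _ ⟨
      x ↑ g ⊗ 1F              ≡⟨ cong (x ↑ g ⊗_) (↑-∣ (n∣m*n v) xj) ⟨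
      x ↑ g ⊗ x ↑ (v * j)     ≡⟨ ↑-homo x g (v * j) ⟨
      x ↑ (g + v * j)         ≡⟨ cong (x ↑_) e ⟩
      x ↑ (u * i)             ≡⟨ ↑-∣ (n∣m*n u) xi ⟩
      1F                      ∎
      where open ≡-Reasoning
    go : Bézout.Identity (gcd i j) i j → x ↑ gcd i j ≡ 1F
    go (Bézout.+- u v e) = combine _ u v i j xi xj e
    go (Bézout.-+ u v e) = combine _ v u j i xj xi e

  module _ (R : ℕ) .{{_ : NonZero R}} (x : F) (xR : x ↑ R ≡ 1F)
           (exact : ∀ g → g ∣ R → g < R → x ↑ g ≢ 1F) where

    private
      x≢0 : x ≢ 0F
      x≢0 = ↑≡1⇒≢0 R xR

    ↑≢0 : ∀ k → x ↑ k ≢ 0F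
    ↑≢0 zero    = 1≢0
    ↑≢0 (suc k) = ⊗-≢0 x≢0 (↑≢0 k)

    -- Otherwise gcd d R, a proper divisor of R, would also be an exponent of x.
    order-exact : ∀ {d} → .{{NonZero d}} → d < R → x ↑ d ≢ 1F
    order-exact {d} d<R e = exact (gcd d R) (gcd[m,n]∣n d R)
      (≤-<-trans (∣⇒≤ (gcd[m,n]∣m d R)) d<R) (↑-gcd x d R e xR)

    ↑-injective-< : ∀ {i j} → i < j → j < R → x ↑ i ≢ x ↑ j
    ↑-injective-< {i} {j} i<j j<R e with ⊗-cancelʳ (x ↑ (j ∸ i)) 1F (x ↑ i)
      (trans (sym (↑-homo x (j ∸ i) i)) (trans (cong (x ↑_) (m∸n+n≡m (<⇒≤ i<j))) (trans (sym e) (sym (⊗-identityˡ _)))))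
    ... | inj₁ z = order-exact {{>-nonZero (m<n⇒0<n∸m i<j)}} (≤-<-trans (m∸n≤m j i) j<R) z
    ... | inj₂ z = ↑≢0 i z

    ↑-injective : ∀ (i j : Fin R) → x ↑ toℕ i ≡ x ↑ toℕ j → i ≡ j
    ↑-injective i j e with <-cmp (toℕ i) (toℕ j)
    ... | tri< i<j _ _ = ⊥-elim (↑-injective-< i<j (toℕ<n j) e)
    ... | tri≈ _ i≡j _ = toℕ-injective i≡j
    ... | tri> _ _ j<i = ⊥-elim (↑-injective-< j<i (toℕ<n i) (sym e))

    -- Otherwise y and the R distinct powers of x are R + 1 roots of Xᴿ = 1.
    generates : ∀ y → y ↑ R ≡ 1F → ∃ λ k → x ↑ k ≡ y
    generates y yR with any? (λ (k : Fin R) → x ↑ toℕ k ≟F y)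
    ... | yes (k , e) = toℕ k , e
    ... | no none = ⊥-elim (<⇒≱ (n<1+n R) (begin
        suc R                                                              ≡⟨ cong suc (*-identityʳ R) ⟨
        1 + R * 1                                                          ≡⟨ cong suc (∑-const {R} 1) ⟨
        1 + ∑ {R} (λ k → 1)                                                ≡⟨ cong suc (∑-cong (λ k → ∑-≟ (x ↑ toℕ k))) ⟨
        1 + ∑ {R} (λ k → ∑ (λ z → 𝟙 (z ≟F x ↑ toℕ k)))                     ≡⟨ cong₂ _+_ (sym (∑-≟ y)) (∑-swap (λ k z → 𝟙 (z ≟F x ↑ toℕ k))) ⟩
        ∑ (λ z → 𝟙 (z ≟F y)) + ∑ (λ z → ∑ {R} (λ k → 𝟙 (z ≟F x ↑ toℕ k)))  ≡⟨ ∑-+ (λ z → 𝟙 (z ≟F y)) _ ⟨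
        ∑ (λ z → 𝟙 (z ≟F y) + ∑ {R} (λ k → 𝟙 (z ≟F x ↑ toℕ k)))            ≤⟨ ∑-mono pointwise ⟩
        card R                                                             ≤⟨ card≤ R ⟩
        R                                                                  ∎))
      where
      open ≤-Reasoning
      pointwise : ∀ z → 𝟙 (z ≟F y) + ∑ {R} (λ k → 𝟙 (z ≟F x ↑ toℕ k)) ≤ μ R z
      pointwise z with any? (λ (k : Fin R) → z ≟F x ↑ toℕ k)
      ... | yes (k , e) = ≤-reflexive (trans (cong₂ _+_ (𝟙-no (z ≟F y) (λ e′ → none (k , trans (sym e) e′)))
              (trans (∑-cong (λ j → 𝟙-cong (z ≟F x ↑ toℕ j) (j ≟F k) (λ e′ → ↑-injective j k (trans (sym e′) e))
                  (λ j≡k → trans e (cong (λ i → x ↑ toℕ i) (sym j≡k))))) (∑-≟ k)))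
              (sym (𝟙-yes (z ↑ R ≟F 1F) (trans (cong (_↑ R) e)
                (trans (↑-assoc x (toℕ k) R) (↑-∣ (n∣m*n (toℕ k)) xR))))))
      ... | no none′ = ≤-trans (≤-reflexive (trans (cong (𝟙 (z ≟F y) +_)
              (∑-zero (λ k → 𝟙-no (z ≟F x ↑ toℕ k) (λ e → none′ (k , e))))) (+-identityʳ _)))
              (𝟙-mono (z ≟F y) (z ↑ R ≟F 1F) (λ e → trans (cong (_↑ R) e) yR))

    -- If u is inverse to L modulo R, then x^u is an L-th root of x.
    root : ∀ L → Coprime L R → ∃ λ u → x ↑ (L * u) ≡ x
    root L cop with coprime-Bézout cop
    ... | Bézout.+- u v e = u , (begin
          x ↑ (L * u)            ≡⟨ cong (x ↑_) (*-comm L u) ⟩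
          x ↑ (u * L)            ≡⟨ cong (x ↑_) e ⟨
          x ⊗ x ↑ (v * R)        ≡⟨ cong (x ⊗_) (↑-∣ (n∣m*n v) xR) ⟩
          x ⊗ 1F                 ≡⟨ ⊗-identityʳ x ⟩
          x                      ∎)
      where open ≡-Reasoning
    -- Here u L is -1 modulo R, so x^(L u) is the inverse of x; raising it to the power R - 1
    -- inverts it again.
    ... | Bézout.-+ u v e with ⊗-cancelʳ (x ↑ (L * (u * pred R))) x (x ↑ pred R) (trans lhs (sym rhs))
      where
      open ≡-Reasoning
      rhs : x ⊗ x ↑ pred R ≡ 1F
      rhs = trans (cong (x ↑_) (suc-pred R)) xR
      xuLx : x ↑ (L * u) ⊗ x ≡ 1F
      xuLx = trans (⊗-comm _ x) (trans (cong (λ k → x ⊗ x ↑ k) (*-comm L u)) (trans (cong (x ↑_) e) (↑-∣ (n∣m*n v) xR)))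
      lhs : x ↑ (L * (u * pred R)) ⊗ x ↑ pred R ≡ 1F
      lhs = begin
        x ↑ (L * (u * pred R)) ⊗ x ↑ pred R    ≡⟨ cong (λ k → x ↑ k ⊗ x ↑ pred R) (*-assoc L u (pred R)) ⟨
        x ↑ (L * u * pred R) ⊗ x ↑ pred R      ≡⟨ cong (_⊗ x ↑ pred R) (↑-assoc x (L * u) (pred R)) ⟨
        (x ↑ (L * u)) ↑ pred R ⊗ x ↑ pred R    ≡⟨ ↑-distrib (x ↑ (L * u)) x (pred R) ⟨
        (x ↑ (L * u) ⊗ x) ↑ pred R             ≡⟨ cong (_↑ pred R) xuLx ⟩
        1F ↑ pred R                            ≡⟨ 1↑ (pred R) ⟩
        1F                                     ∎
    ...   | inj₁ z = u * pred R , z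
    ...   | inj₂ z = ⊥-elim (↑≢0 (pred R) z)

    -- Since x has an L-th root among its own powers, the x^(L τ) run through all of μ_R. One of
    -- them is the inverse of w = x^j₀ t, which is w^(R - 1).
    exponent : ∀ L → Coprime L R → ∀ j₀ t → t ↑ R ≡ 1F → ∃ λ τ → x ↑ (j₀ + L * τ) ⊗ t ≡ 1F
    exponent L cop j₀ t tR with root L cop | generates ((x ↑ j₀ ⊗ t) ↑ pred R) wR
      where
      w = x ↑ j₀ ⊗ t
      wR₀ : w ↑ R ≡ 1F
      wR₀ = trans (↑-distrib (x ↑ j₀) t R) (trans (cong₂ _⊗_ (trans (↑-assoc x j₀ R) (↑-∣ (n∣m*n j₀) xR)) tR) (⊗-identityˡ 1F))
      wR : (w ↑ pred R) ↑ R ≡ 1F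
      wR = trans (↑-assoc w (pred R) R) (↑-∣ (n∣m*n (pred R)) wR₀)
    ... | u , xLu | k , xk = u * k , (begin
        x ↑ (j₀ + L * (u * k)) ⊗ t                ≡⟨ cong (_⊗ t) (↑-homo x j₀ (L * (u * k))) ⟩
        x ↑ j₀ ⊗ x ↑ (L * (u * k)) ⊗ t            ≡⟨ cong (λ z → x ↑ j₀ ⊗ z ⊗ t) powers ⟩
        x ↑ j₀ ⊗ w ↑ pred R ⊗ t                   ≡⟨ solve 3 (λ a b c → a :* b :* c := a :* c :* b) refl (x ↑ j₀) (w ↑ pred R) t ⟩
        w ⊗ w ↑ pred R                            ≡⟨ cong (w ↑_) (suc-pred R) ⟩
        w ↑ R                                     ≡⟨ wR ⟩
        1F                                        ∎)
      where
      open ≡-Reasoning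
      w = x ↑ j₀ ⊗ t
      wR : w ↑ R ≡ 1F
      wR = trans (↑-distrib (x ↑ j₀) t R) (trans (cong₂ _⊗_ (trans (↑-assoc x j₀ R) (↑-∣ (n∣m*n j₀) xR)) tR) (⊗-identityˡ 1F))
      powers : x ↑ (L * (u * k)) ≡ w ↑ pred R
      powers = trans (cong (x ↑_) (sym (*-assoc L u k))) (trans (sym (↑-assoc x (L * u) k)) (trans (cong (_↑ k) xLu) xk))

-- From prime moduli to squarefree moduli

prime-divisor : ∀ {q} → 1 < q → ∃ λ ℓ → Prime ℓ × ℓ ∣ q
prime-divisor {q@(suc _)} 1<q with factorise q
... | record { factors = [] ; isFactorisation = e } = ⊥-elim (<⇒≢ 1<q (sym e))
... | record { factors = ℓ ∷ ps ; isFactorisation = e ; factorsPrime = pr ∷ _ } =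
  ℓ , pr , divides (product ps) (trans e (*-comm ℓ (product ps)))

cofactors : ∀ {R} ps → All (_∣ R) ps → List ℕ
cofactors []       []        = []
cofactors (ℓ ∷ ps) (d ∷ ds) = quotient d ∷ cofactors ps ds

length-cofactors : ∀ {R} ps (ds : All (_∣ R) ps) → length (cofactors ps ds) ≡ length ps
length-cofactors []       []       = refl
length-cofactors (ℓ ∷ ps) (d ∷ ds) = cong suc (length-cofactors ps ds)

2^length≤product : ∀ {ps} → All Prime ps → 2 ^ length ps ≤ product ps
2^length≤product []                  = ≤-refl
2^length≤product {ℓ ∷ _} (pr ∷ prs) = *-mono-≤ (nonTrivial⇒n>1 ℓ {{prime⇒nonTrivial pr}}) (2^length≤product prs)

factors-divide : ∀ ps → All (_∣ product ps) ps
factors-divide []       = []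
factors-divide (ℓ ∷ ps) = divides (product ps) (*-comm ℓ (product ps))
  ∷ All.map (λ {d} d∣ → ∣-trans d∣ (divides ℓ refl)) (factors-divide ps)

-- The witness consists of the R / ℓ, for the prime factors ℓ of R.
maximal-divisors : ∀ R → .{{_ : NonZero R}} → ∀ B → (∀ d → d ∣ R → 1 < d → B ≤ d) →
  ∃ λ cs → All (λ c → c ∣ R × c * B ≤ R × NonZero c) cs × 2 ^ length cs ≤ R
         × (∀ g → g ∣ R → g < R → Any (g ∣_) cs)
maximal-divisors R B rough with factorise R
... | record { factors = ps ; isFactorisation = refl ; factorsPrime = prs } =
    cofactors ps ds , small ps ds prs
  , ≤-trans (≤-reflexive (cong (2 ^_) (length-cofactors ps ds))) (2^length≤product prs)
  , maximal
  where
  ds : All (_∣ R) ps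
  ds = factors-divide ps
  small : ∀ qs (es : All (_∣ R) qs) → All Prime qs →
          All (λ c → c ∣ R × c * B ≤ R × NonZero c) (cofactors qs es)
  small []       []        _          = []
  small (ℓ ∷ qs) (e ∷ es) (pr ∷ prs) =
    (quotient-∣ e
    , ≤-trans (*-monoʳ-≤ (quotient e) (rough ℓ e (nonTrivial⇒n>1 ℓ {{prime⇒nonTrivial pr}})))
        (≤-reflexive (sym (m∣n⇒n≡quotient*m e)))
    , ≢-nonZero (λ q≡0 → ≢-nonZero⁻¹ R (trans (m∣n⇒n≡quotient*m e) (cong (_* ℓ) q≡0))))
    ∷ small qs es prs
  locate : ∀ {g ℓ} qs (es : All (_∣ R) qs) → ℓ ∈ qs → ℓ * g ∣ R → .{{_ : NonZero ℓ}} → Any (g ∣_) (cofactors qs es)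
  locate {g} {ℓ} (_ ∷ qs) (e ∷ es) (here refl) (divides k R≡) =
    here (divides k (*-cancelʳ-≡ (quotient e) (k * g) ℓ
      (trans (sym (m∣n⇒n≡quotient*m e)) (trans R≡ (assoc k ℓ g)))))
    where
    assoc : ∀ k ℓ g → k * (ℓ * g) ≡ k * g * ℓ
    assoc = solve-∀
  locate (_ ∷ qs) (e ∷ es) (there ℓ∈) d = there (locate qs es ℓ∈ d)
  maximal : ∀ g → g ∣ R → g < R → Any (g ∣_) (cofactors ps ds)
  maximal g g∣R@(divides q R≡) g<R with prime-divisor {q} (quotient>1 g∣R g<R)
  ... | ℓ , pr , divides k q≡ = locate ps ds
      (factorisationHasAllPrimeFactors pr (divides (k * g) (trans R≡ (trans (cong (_* g) q≡) (swap k ℓ g)))) prs)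
      (divides k (trans R≡ (trans (cong (_* g) q≡) (*-assoc k ℓ g)))) {{prime⇒nonZero pr}}
    where
    swap : ∀ k ℓ g → k * ℓ * g ≡ k * g * ℓ
    swap = solve-∀

-- The subtraction-free form x^(j + 1) ≡ x^j + a, with a replaced by its residue. The exponent k of
-- the definition of good is j + 1, hence positive.
record SolvesMod (a : ℤ) (n x j : ℕ) : Set where
  constructor solution
  field
    unit       : ¬ (suc n ∣ x)
    congruence : x ^ suc j % suc n ≡ (x ^ j + a %ℕ suc n) % suc n

-- The class of the exponent modulo L is prescribed because L will be the product of the q - 1 over
-- the smaller primes q, so that the solutions already found there survive.
Solvable : ℕ → ℕ → Set
Solvable n R = ∀ a j L → Coprime L R → ∃ λ x → ∃ λ τ → SolvesMod a n x (j + L * τ)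

pos-^ : ∀ x k → (pos x) ℤ.^ k ≡ pos (x ^ k)
pos-^ x zero    = refl
pos-^ x (suc k) = trans (cong (λ z → pos x ℤ.* z) (pos-^ x k)) (sym (ℤ.pos-* x (x ^ k)))

solvesMod⇒∣ : ∀ {a n x j} → SolvesMod a n x j → pos (suc n) ℤ.∣ (((pos x) ℤ.^ suc j ℤ.- (pos x) ℤ.^ j) ℤ.- a)
solvesMod⇒∣ {a} {n} {x} {j} (solution _ e) = Signed.∣⇒∣ᵤ (Signed.divides (q ℤ.- q′ ℤ.- s) (begin
    ((pos x) ℤ.^ suc j ℤ.- (pos x) ℤ.^ j) ℤ.- a
      ≡⟨ cong₂ (λ u v → (u ℤ.- v) ℤ.- a) (pos-^ x (suc j)) (pos-^ x j) ⟩
    (pos (x ^ suc j) ℤ.- pos (x ^ j)) ℤ.- a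
      ≡⟨ cong₂ (λ u v → (u ℤ.- v) ℤ.- a) (expand (x ^ suc j)) refl ⟩
    ((r ℤ.+ q ℤ.* pos p) ℤ.- pos (x ^ j)) ℤ.- a
      ≡⟨ cong (λ u → ((r ℤ.+ q ℤ.* pos p) ℤ.- pos (x ^ j)) ℤ.- u) (a≡a%ℕn+[a/ℕn]*n a p) ⟩
    ((r ℤ.+ q ℤ.* pos p) ℤ.- pos (x ^ j)) ℤ.- (pos a₀ ℤ.+ s ℤ.* pos p)
      ≡⟨ regroup r q (pos p) (pos (x ^ j)) (pos a₀) s ⟩
    (r ℤ.+ q ℤ.* pos p) ℤ.- (pos (x ^ j) ℤ.+ pos a₀) ℤ.- s ℤ.* pos p
      ≡⟨ cong (λ u → (r ℤ.+ q ℤ.* pos p) ℤ.- u ℤ.- s ℤ.* pos p) (trans (sym (ℤ.pos-+ (x ^ j) a₀)) (expand (x ^ j + a₀))) ⟩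
    (r ℤ.+ q ℤ.* pos p) ℤ.- (pos ((x ^ j + a₀) % p) ℤ.+ q′ ℤ.* pos p) ℤ.- s ℤ.* pos p
      ≡⟨ cong (λ u → (r ℤ.+ q ℤ.* pos p) ℤ.- (pos u ℤ.+ q′ ℤ.* pos p) ℤ.- s ℤ.* pos p) e ⟨
    (r ℤ.+ q ℤ.* pos p) ℤ.- (r ℤ.+ q′ ℤ.* pos p) ℤ.- s ℤ.* pos p
      ≡⟨ finish r q (pos p) q′ s ⟩
    (q ℤ.- q′ ℤ.- s) ℤ.* pos p ∎))
  where
  open ≡-Reasoning
  p = suc n
  a₀ = a %ℕ p
  s = a /ℕ p
  r = pos (x ^ suc j % p)
  q = pos (x ^ suc j / p)
  q′ = pos ((x ^ j + a₀) / p)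
  expand : ∀ u → pos u ≡ pos (u % p) ℤ.+ pos (u / p) ℤ.* pos p
  expand u = trans (cong pos (m≡m%n+[m/n]*n u p)) (trans (ℤ.pos-+ (u % p) (u / p * p)) (cong (λ z → pos (u % p) ℤ.+ z) (ℤ.pos-* (u / p) p)))
  regroup : ∀ r q p X a₀ s → ((r ℤ.+ q ℤ.* p) ℤ.- X) ℤ.- (a₀ ℤ.+ s ℤ.* p) ≡ (r ℤ.+ q ℤ.* p) ℤ.- (X ℤ.+ a₀) ℤ.- s ℤ.* p
  regroup = ℤSolver.solve-∀
  finish : ∀ r q p q′ s → (r ℤ.+ q ℤ.* p) ℤ.- (r ℤ.+ q′ ℤ.* p) ℤ.- s ℤ.* p ≡ (q ℤ.- q′ ℤ.- s) ℤ.* p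
  finish = ℤSolver.solve-∀

prime∤! : ∀ {p} → Prime p → ∀ k → k < p → ¬ p ∣ k !
prime∤! pr zero    _   p∣1 = ¬prime[1] (subst Prime (∣1⇒≡1 p∣1) pr)
prime∤! pr (suc k) k<p p∣  with euclidsLemma (suc k) (k !) pr p∣
... | inj₁ p∣sk = <⇒≱ k<p (∣⇒≤ p∣sk)
... | inj₂ p∣k! = prime∤! pr k (<-trans (n<1+n k) k<p) p∣k!

module _ (n : ℕ) (pr : Prime (suc n)) where
  open PrimeField n pr

  ι≢0 : ∀ {x} → ¬ (suc n ∣ x) → ι x ≢ 0F
  ι≢0 {x} ¬p∣x e = ¬p∣x (m%n≡0⇒n∣m x p (ι-injective e))

  ι≢0⁻¹ : ∀ {x} → ι x ≢ 0F → ¬ (suc n ∣ x)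
  ι≢0⁻¹ {x} ιx≢0 p∣x = ιx≢0 (ι-cong (n∣m⇒m%n≡0 x p p∣x))

  field-solution : ∀ {a x j} → ι x ≢ 0F → ι x ↑ suc j ≡ ι x ↑ j ⊕ ι (a %ℕ p) → SolvesMod a n x j
  field-solution {a} {x} {j} x≢0 e = solution (ι≢0⁻¹ x≢0) (ι-injective (begin
    ι (x ^ suc j)              ≡⟨ ι-^ x (suc j) ⟩
    ι x ↑ suc j                ≡⟨ e ⟩
    ι x ↑ j ⊕ ι (a %ℕ p)       ≡⟨ cong (_⊕ ι (a %ℕ p)) (ι-^ x j) ⟨
    ι (x ^ j) ⊕ ι (a %ℕ p)     ≡⟨ ι-+ (x ^ j) (a %ℕ p) ⟨
    ι (x ^ j + a %ℕ p)         ∎))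
    where open ≡-Reasoning

  field-solution⁻¹ : ∀ {a x j} → SolvesMod a n x j → ι x ↑ suc j ≡ ι x ↑ j ⊕ ι (a %ℕ p)
  field-solution⁻¹ {a} {x} {j} (solution _ e) = begin
    ι x ↑ suc j                ≡⟨ ι-^ x (suc j) ⟨
    ι (x ^ suc j)              ≡⟨ ι-cong e ⟩
    ι (x ^ j + a %ℕ p)         ≡⟨ ι-+ (x ^ j) (a %ℕ p) ⟩
    ι (x ^ j) ⊕ ι (a %ℕ p)     ≡⟨ cong (_⊕ ι (a %ℕ p)) (ι-^ x j) ⟩
    ι x ↑ j ⊕ ι (a %ℕ p)       ∎
    where open ≡-Reasoning

  -- By Fermat the powers of x have period n = p - 1, which divides L.
  solvesMod-shift : ∀ {a x x′ j} L τ → SolvesMod a n x j → ι x′ ≡ ι x → n ∣ L → SolvesMod a n x′ (j + L * τ)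
  solvesMod-shift {a} {x} {x′} {j} L τ sol@(solution x≢0 _) e n∣L = field-solution {a} {x′} {j + L * τ}
    (λ e′ → ι≢0 x≢0 (trans (sym e) e′)) (begin
    ι x′ ⊗ ι x′ ↑ (j + L * τ)                  ≡⟨ cong (λ z → z ⊗ z ↑ (j + L * τ)) e ⟩
    ι x ⊗ ι x ↑ (j + L * τ)                    ≡⟨ cong (ι x ⊗_) period ⟩
    ι x ⊗ ι x ↑ j                              ≡⟨ field-solution⁻¹ {a} {x} {j} sol ⟩
    ι x ↑ j ⊕ ι (a %ℕ p)                       ≡⟨ cong (_⊕ ι (a %ℕ p)) period ⟨
    ι x ↑ (j + L * τ) ⊕ ι (a %ℕ p)             ≡⟨ cong (λ z → z ↑ (j + L * τ) ⊕ ι (a %ℕ p)) e ⟨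
    ι x′ ↑ (j + L * τ) ⊕ ι (a %ℕ p)            ∎)
    where
    open ≡-Reasoning
    period : ι x ↑ (j + L * τ) ≡ ι x ↑ j
    period = trans (↑-homo (ι x) j (L * τ)) (trans (cong (ι x ↑ j ⊗_)
      (↑-∣ (∣-trans n∣L (m∣m*n τ)) (fermat (ι x) (ι≢0 x≢0)))) (⊗-identityʳ _))

  -- Chinese remaindering against all smaller primes at once.
  adjust : ∀ x y → ∃ λ s → ι (x + n ! * s) ≡ ι y
  adjust x y = toℕ (g ⊗ (ι y ⊕ ⊖ ι x)) , (begin
    ι (x + n ! * toℕ (g ⊗ d))       ≡⟨ ι-+ x _ ⟩
    ι x ⊕ ι (n ! * toℕ (g ⊗ d))     ≡⟨ cong (ι x ⊕_) (ι-* (n !) _) ⟩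
    ι x ⊕ f ⊗ ι (toℕ (g ⊗ d))       ≡⟨ cong (λ z → ι x ⊕ f ⊗ z) (ι-toℕ (g ⊗ d)) ⟩
    ι x ⊕ f ⊗ (g ⊗ d)               ≡⟨ cong (ι x ⊕_) (⊗-assoc f g d) ⟨
    ι x ⊕ f ⊗ g ⊗ d                 ≡⟨ cong (λ z → ι x ⊕ z ⊗ d) (trans (⊗-comm f g) gf) ⟩
    ι x ⊕ 1F ⊗ d                    ≡⟨ cong (ι x ⊕_) (⊗-identityˡ d) ⟩
    ι x ⊕ (ι y ⊕ ⊖ ι x)             ≡⟨ ⊕-comm (ι x) d ⟩
    ι y ⊕ ⊖ ι x ⊕ ι x               ≡⟨ ⊕-assoc (ι y) (⊖ ι x) (ι x) ⟩
    ι y ⊕ (⊖ ι x ⊕ ι x)             ≡⟨ cong (ι y ⊕_) (trans (⊕-comm (⊖ ι x) (ι x)) (⊕-inverseʳ (ι x))) ⟩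
    ι y ⊕ 0F                        ≡⟨ ⊕-identityʳ (ι y) ⟩
    ι y                             ∎)
    where
    open ≡-Reasoning
    f = ι (n !)
    f≢0 : f ≢ 0F
    f≢0 = ι≢0 (prime∤! pr n (n<1+n n))
    g = proj₁ (inverse f f≢0)
    gf = proj₂ (inverse f f≢0)
    d = ι y ⊕ ⊖ ι x

  module _ (A R B i Z : ℕ) .{{_ : NonZero R}} .{{_ : NonZero B}} (n≡AR : n ≡ A * R)
    (rough : ∀ d → d ∣ R → 1 < d → B ≤ d) (n< : n < 2 ^ suc i) (i≤B : 2 * suc i ≤ B)
    (p³≤Z² : p * p * p ≤ Z * Z) (Z< : 2 * suc (suc i) * Z < R * R) where

    -- Applied with k the number of prime factors of R, counted with multiplicity: their product is
    -- at least 2^k, while R ≤ n < 2^(i + 1).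
    short : ∀ {k} → 2 ^ k ≤ R → k ≤ i
    short {k} 2^k≤R with k ≤? i
    ... | yes k≤i = k≤i
    ... | no k≰i = ⊥-elim (<⇒≱ n< (≤-trans (^-monoʳ-≤ 2 (≰⇒> k≰i)) (≤-trans 2^k≤R R≤n)))
      where
      R≤n : R ≤ n
      R≤n = ∣⇒≤ {{>-nonZero (s≤s⁻¹ 1<p)}} (divides A n≡AR)

    -- Every proper divisor of R divides some R / ℓ with ℓ prime, so avoiding these at most i
    -- exponents already forces x = 1 + α t to have order exactly R.
    exists-generator : ∀ α → α ≢ 0F → ∃ λ t → t ↑ R ≡ 1F × (1F ⊕ α ⊗ t) ↑ R ≡ 1F ×
      (∀ g → g ∣ R → g < R → (1F ⊕ α ⊗ t) ↑ g ≢ 1F)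
    exists-generator α α≢0 =
      let cs , small , 2^len≤R , maximal = maximal-divisors R B rough
          len≤ = ≤-trans (short {length cs} 2^len≤R) (n≤1+n i)
          t , tR , xR , avoid = exists-avoiding Z p³≤Z² A R B n≡AR α α≢0 cs small
             (≤-trans (*-monoʳ-≤ 2 len≤) i≤B)
             (≤-<-trans (*-monoˡ-≤ Z (*-monoʳ-≤ 2 (s≤s len≤))) Z<)
      in t , tR , xR , λ g g∣R g<R → clash (1F ⊕ α ⊗ t) g cs avoid (maximal g g∣R g<R)
      where
      clash : ∀ x g cs → All (λ c → x ↑ c ≢ 1F) cs → Any (g ∣_) cs → x ↑ g ≢ 1F
      clash x g _ (x≢ ∷ _) (here g∣c) e = x≢ (↑-∣ g∣c e)
      clash x g _ (_ ∷ al) (there an) e = clash x g _ al an e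

    field-solvable : ∀ α j L → Coprime L R → ∃ λ x → ∃ λ τ → x ≢ 0F × x ↑ suc (j + L * τ) ≡ x ↑ (j + L * τ) ⊕ α
    field-solvable α j L cop with α ≟F 0F
    ... | yes α≡0 = 1F , 0 , 1≢0 ,
          trans (1↑ (suc (j + L * 0))) (sym (trans (cong₂ _⊕_ (1↑ (j + L * 0)) α≡0) (⊕-identityʳ 1F)))
    -- With y = x^(j + L τ) and y t = 1, the difference y (x - 1) = y α t equals α.
    ... | no α≢0 = 1F ⊕ α ⊗ t , τ , ↑≡1⇒≢0 R xR , eq
      where
      t = proj₁ (exists-generator α α≢0)
      tR = proj₁ (proj₂ (exists-generator α α≢0))
      xR = proj₁ (proj₂ (proj₂ (exists-generator α α≢0)))
      exact = proj₂ (proj₂ (proj₂ (exists-generator α α≢0)))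
      x = 1F ⊕ α ⊗ t
      τ = proj₁ (exponent R x xR exact L cop j t tR)
      y = x ↑ (j + L * τ)
      yt : y ⊗ t ≡ 1F
      yt = proj₂ (exponent R x xR exact L cop j t tR)
      open ≡-Reasoning
      eq : x ⊗ y ≡ y ⊕ α
      eq = begin
        x ⊗ y                   ≡⟨ ⊗-comm x y ⟩
        y ⊗ (1F ⊕ α ⊗ t)        ≡⟨ ⊗-distribˡ-⊕ y 1F (α ⊗ t) ⟩
        y ⊗ 1F ⊕ y ⊗ (α ⊗ t)    ≡⟨ cong₂ _⊕_ (⊗-identityʳ y) (cong (y ⊗_) (⊗-comm α t)) ⟩
        y ⊕ y ⊗ (t ⊗ α)         ≡⟨ cong (y ⊕_) (⊗-assoc y t α) ⟨
        y ⊕ y ⊗ t ⊗ α           ≡⟨ cong (λ z → y ⊕ z ⊗ α) yt ⟩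
        y ⊕ 1F ⊗ α              ≡⟨ cong (y ⊕_) (⊗-identityˡ α) ⟩
        y ⊕ α                   ∎

    solvable : Solvable n R
    solvable a j L cop with x , τ , x≢0 , e ← field-solvable (ι (a %ℕ p)) j L cop =
      toℕ x , τ , field-solution (subst (_≢ 0F) (sym (ι-toℕ x)) x≢0)
        (subst (λ z → z ↑ suc (j + L * τ) ≡ z ↑ (j + L * τ) ⊕ ι (a %ℕ p)) (sym (ι-toℕ x)) e)

-- A prime ℓ dividing m / gcd m v divides m, hence v, hence the gcd, and then ℓ² would divide m. So
-- the cofactor is 1.
squarefree-∣ : ∀ m v → .{{_ : NonZero m}} → (∀ {ℓ} → Prime ℓ → ℓ ∣ m → ¬ ℓ * ℓ ∣ m) → (∀ {ℓ} → Prime ℓ → ℓ ∣ m → ℓ ∣ v) → m ∣ v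
squarefree-∣ m v sf divs with gcd[m,n]∣m m v
... | divides 0 m≡ = ⊥-elim (≢-nonZero⁻¹ m m≡)
... | divides 1 m≡ = subst (_∣ v) (sym (trans m≡ (*-identityˡ _))) (gcd[m,n]∣n m v)
... | divides c@(suc (suc _)) m≡ with prime-divisor {c} (s≤s (s≤s z≤n))
... | ℓ , pr , ℓ∣c = ⊥-elim (sf pr ℓ∣m (subst (ℓ * ℓ ∣_) (sym m≡) (*-pres-∣ ℓ∣c (gcd-greatest ℓ∣m (divs pr ℓ∣m)))))
  where
  ℓ∣m : ℓ ∣ m
  ℓ∣m = subst (ℓ ∣_) (sym m≡) (∣m⇒∣m*n (gcd m v) ℓ∣c)

coprime-* : ∀ {a b r} → Coprime a r → Coprime b r → Coprime (a * b) r
coprime-* {a} {b} {r} ca cb {d} (d∣ab , d∣r) = cb (coprime-divisor {d} {a} (λ { (e∣d , e∣a) → ca (e∣a , ∣-trans e∣d d∣r) }) d∣ab , d∣r)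

module _ (m : ℕ) .{{m≢0 : NonZero m}} (squarefree : ∀ {ℓ} → Prime ℓ → ℓ ∣ m → ¬ ℓ * ℓ ∣ m)
         (local : ∀ n → Prime (suc n) → suc n ∣ m → ∃ λ R → Solvable n R ×
           (∀ k → Prime (suc k) → suc k ∣ m → k < n → Coprime k R)) where

  -- The state after treating the primes k + 1 ≤ b that divide m. L is the product of these k; the
  -- field `coprime` expresses this by its consequence for coprimality.
  record Partial (a : ℤ) (b : ℕ) : Set where
    field
      x j L    : ℕ
      solves   : ∀ k → Prime (suc k) → suc k ∣ m → k < b → SolvesMod a k x j
      period   : ∀ k → Prime (suc k) → suc k ∣ m → k < b → k ∣ L
      coprime  : ∀ r → (∀ k → Prime (suc k) → suc k ∣ m → k < b → Coprime k r) → Coprime L r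

  partial : ∀ a b → Partial a b
  partial a zero = record { x = 0 ; j = 0 ; L = 1 ; solves = λ _ _ _ () ; period = λ _ _ _ ()
                          ; coprime = λ r _ (d∣1 , _) → ∣1⇒≡1 d∣1 }
  partial a (suc n) with partial a n | prime? (suc n) ×-dec suc n ∣? m
  ... | P | no skip = record { x = x ; j = j ; L = L
      ; solves = λ k pk k∣m k< → solves k pk k∣m (shrink k pk k∣m k<)
      ; period = λ k pk k∣m k< → period k pk k∣m (shrink k pk k∣m k<)
      ; coprime = λ r h → coprime r (λ k pk k∣m k< → h k pk k∣m (<-trans k< (n<1+n n))) }
    where
    open Partial P
    shrink : ∀ k → Prime (suc k) → suc k ∣ m → k < suc n → k < n
    shrink k pk k∣m k< = ≤∧≢⇒< (s≤s⁻¹ k<) (λ { refl → skip (pk , k∣m) })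
  ... | P | yes (pn , n∣m) with R , solvableₙ , indep ← local n pn n∣m
      with solvableₙ a (Partial.j P) (Partial.L P) (Partial.coprime P R indep)
  ... | y , τ , sol-y with adjust n pn (Partial.x P) y
  ... | s , x′≡y = record { x = x′ ; j = j + L * τ ; L = n * L
      ; solves = solves′ ; period = period′ ; coprime = coprime′ }
    where
    open Partial P
    x′ = x + n ! * s
    solves′ : ∀ k → Prime (suc k) → suc k ∣ m → k < suc n → SolvesMod a k x′ (j + L * τ)
    solves′ k pk k∣m k< with k <? n
    ... | yes k<n = solvesMod-shift k pk L τ (solves k pk k∣m k<n)
          (PrimeField.ι-cong k pk (%-remove-+ʳ x (∣-trans (∣-trans (m∣m*n (k !)) (m≤n⇒m!∣n! k<n)) (m∣m*n s)))) (period k pk k∣m k<n)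
    ... | no k≮n with ≤-antisym (s≤s⁻¹ k<) (≮⇒≥ k≮n)
    -- At the new prime the exponent is shifted by zero; the lemma serves to replace y by the
    -- congruent x′.
    ... | refl = subst (SolvesMod a n x′) (trans (cong (j + L * τ +_) (*-zeroʳ n)) (+-identityʳ _))
          (solvesMod-shift n pn n 0 sol-y x′≡y ∣-refl)
    period′ : ∀ k → Prime (suc k) → suc k ∣ m → k < suc n → k ∣ n * L
    period′ k pk k∣m k< with k <? n
    ... | yes k<n = ∣n⇒∣m*n n (period k pk k∣m k<n)
    ... | no k≮n with ≤-antisym (s≤s⁻¹ k<) (≮⇒≥ k≮n)
    ... | refl = m∣m*n L
    coprime′ : ∀ r → (∀ k → Prime (suc k) → suc k ∣ m → k < suc n → Coprime k r) → Coprime (n * L) r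
    coprime′ r h = coprime-* (h n pn n∣m (n<1+n n)) (coprime r (λ k pk k∣m k< → h k pk k∣m (<-trans k< (n<1+n n))))

  good : Good m
  good a = j , pos x , cong pos (coprime⇒gcd≡1 x⊥m) , squarefree-∣ m _ squarefree divs
    where
    -- The bound m suffices, since a prime divisor k + 1 of m has k < m.
    open Partial (partial a m)
    solves-prime : ∀ {k} → Prime (suc k) → suc k ∣ m → SolvesMod a k x j
    solves-prime {k} pk k∣m = solves k pk k∣m (∣⇒≤ k∣m)
    divs : ∀ {ℓ} → Prime ℓ → ℓ ∣ m → ℓ ∣ ℤ.∣ ((pos x) ℤ.^ suc j ℤ.- (pos x) ℤ.^ j) ℤ.- a ∣
    divs {zero}  pr _  = ⊥-elim (¬prime[0] pr)
    divs {suc k} pk k∣m = solvesMod⇒∣ {a} {k} {x} {j} (solves-prime pk k∣m)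
    x⊥m : Coprime x m
    x⊥m {zero} (_ , 0∣m) = ⊥-elim (≢-nonZero⁻¹ m (0∣⇒≡0 0∣m))
    x⊥m {suc zero} _ = refl
    x⊥m {suc (suc d)} (d∣x , d∣m) with prime-divisor {suc (suc d)} (s≤s (s≤s z≤n))
    ... | zero  , pr , _    = ⊥-elim (¬prime[0] pr)
    ... | suc k , pk , ℓ∣d = ⊥-elim (SolvesMod.unit (solves-prime pk (∣-trans ℓ∣d d∣m)) (∣-trans ℓ∣d d∣x))

-- Sums over initial segments of ℕ

Σ< : ℕ → (ℕ → ℕ) → ℕ
Σ< zero    f = 0
Σ< (suc n) f = Σ< n f + f n

Σ<-mono : ∀ n {f g : ℕ → ℕ} → (∀ i → i < n → f i ≤ g i) → Σ< n f ≤ Σ< n g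
Σ<-mono zero    h = z≤n
Σ<-mono (suc n) h = +-mono-≤ (Σ<-mono n (λ i i<n → h i (<-trans i<n (n<1+n n)))) (h n (n<1+n n))

Σ<-cong : ∀ n {f g : ℕ → ℕ} → (∀ i → i < n → f i ≡ g i) → Σ< n f ≡ Σ< n g
Σ<-cong n h = ≤-antisym (Σ<-mono n (λ i i< → ≤-reflexive (h i i<))) (Σ<-mono n (λ i i< → ≤-reflexive (sym (h i i<))))

Σ<-const : ∀ n c → Σ< n (λ _ → c) ≡ n * c
Σ<-const zero    c = refl
Σ<-const (suc n) c = trans (cong (_+ c) (Σ<-const n c)) (+-comm (n * c) c)

Σ<-≤const : ∀ n {f : ℕ → ℕ} {c} → (∀ i → i < n → f i ≤ c) → Σ< n f ≤ n * c
Σ<-≤const n {c = c} h = ≤-trans (Σ<-mono n h) (≤-reflexive (Σ<-const n c))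

Σ<-+ : ∀ n (f g : ℕ → ℕ) → Σ< n (λ i → f i + g i) ≡ Σ< n f + Σ< n g
Σ<-+ zero    f g = refl
Σ<-+ (suc n) f g = trans (cong (_+ (f n + g n)) (Σ<-+ n f g)) (interchange (Σ< n f) (Σ< n g) (f n) (g n))
  where
  interchange : ∀ a b c d → a + b + (c + d) ≡ a + c + (b + d)
  interchange = solve-∀

Σ<-*ˡ : ∀ n c (f : ℕ → ℕ) → Σ< n (λ i → c * f i) ≡ c * Σ< n f
Σ<-*ˡ zero    c f = sym (*-zeroʳ c)
Σ<-*ˡ (suc n) c f = trans (cong (_+ c * f n) (Σ<-*ˡ n c f)) (sym (*-distribˡ-+ c (Σ< n f) (f n)))

Σ<-*ʳ : ∀ n c (f : ℕ → ℕ) → Σ< n (λ i → f i * c) ≡ Σ< n f * c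
Σ<-*ʳ n c f = trans (Σ<-cong n (λ i _ → *-comm (f i) c)) (trans (Σ<-*ˡ n c f) (*-comm c _))

Σ<-swap : ∀ m n (f : ℕ → ℕ → ℕ) → Σ< m (λ i → Σ< n (f i)) ≡ Σ< n (λ j → Σ< m (λ i → f i j))
Σ<-swap zero    n f = sym (trans (Σ<-const n 0) (*-zeroʳ n))
Σ<-swap (suc m) n f = trans (cong (_+ Σ< n (f m)) (Σ<-swap m n f)) (sym (Σ<-+ n (λ j → Σ< m (λ i → f i j)) (f m)))

Σ<-split : ∀ m n (f : ℕ → ℕ) → Σ< (m + n) f ≡ Σ< m f + Σ< n (λ i → f (m + i))
Σ<-split m zero    f = trans (cong (λ k → Σ< k f) (+-identityʳ m)) (sym (+-identityʳ _))
Σ<-split m (suc n) f = trans (cong (λ k → Σ< k f) (+-suc m n))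
  (trans (cong (_+ f (m + n)) (Σ<-split m n f)) (+-assoc (Σ< m f) _ _))

Σ<-extend : ∀ {m n} → m ≤ n → ∀ (f : ℕ → ℕ) → Σ< m f ≤ Σ< n f
Σ<-extend {m} {n} m≤n f = ≤-trans (m≤m+n _ _) (≤-reflexive (trans (sym (Σ<-split m (n ∸ m) f)) (cong (λ k → Σ< k f) (m+[n∸m]≡n m≤n))))

term≤Σ< : ∀ {n i} → i < n → ∀ (f : ℕ → ℕ) → f i ≤ Σ< n f
term≤Σ< {n} {i} i<n f = ≤-trans (m≤n+m (f i) (Σ< i f)) (Σ<-extend i<n f)

-- Σ 1/ℓ² < 1/b over ℓ > b.
Σ<-inverse-squares : ∀ n b X (f : ℕ → ℕ) → (∀ i → i < n → (suc b + i) * (suc b + i) * f i ≤ X) → b * Σ< n f ≤ X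
Σ<-inverse-squares zero    b X f h = ≤-trans (≤-reflexive (*-zeroʳ b)) z≤n
Σ<-inverse-squares (suc n) b X f h = *-cancelˡ-≤ (suc b * suc b) (begin
  suc b * suc b * (b * Σ< (suc n) f)                    ≡⟨ cong (λ z → suc b * suc b * (b * z)) (Σ<-split 1 n f) ⟩
  suc b * suc b * (b * (f 0 + S))                       ≡⟨ expand b (f 0) S ⟩
  b * (suc b * suc b * f 0) + b * suc b * (suc b * S)   ≤⟨ +-mono-≤ (*-monoʳ-≤ b head) (*-monoʳ-≤ (b * suc b) tail) ⟩
  b * X + b * suc b * X                                 ≤⟨ m≤m+n _ X ⟩
  b * X + b * suc b * X + X                             ≡⟨ collect b X ⟩
  suc b * suc b * X                                     ∎)
  where
  open ≤-Reasoning
  S = Σ< n (λ i → f (suc i))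
  head : suc b * suc b * f 0 ≤ X
  head = subst (λ k → k * k * f 0 ≤ X) (+-identityʳ (suc b)) (h 0 (s≤s z≤n))
  tail : suc b * S ≤ X
  tail = Σ<-inverse-squares n (suc b) X (λ i → f (suc i))
    (λ i i<n → subst (λ k → k * k * f (suc i) ≤ X) (+-suc (suc b) i) (h (suc i) (s≤s i<n)))
  expand : ∀ b x S → suc b * suc b * (b * (0 + x + S)) ≡ b * (suc b * suc b * x) + b * suc b * (suc b * S)
  expand = solve-∀
  collect : ∀ b X → b * X + b * suc b * X + X ≡ suc b * suc b * X
  collect = solve-∀

module _ {P : ℕ → Set} (P? : ∀ k → Dec (P k)) (d M : ℕ) (spaced : ∀ {k l} → k < l → P k → P l → k + d ≤ l) where

  private
    count : ℕ → ℕ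
    count K = Σ< K (λ k → 𝟙 (P? k))

    last-hit : ∀ K c → count K ≡ suc c → ∃ λ k → k < K × P k × d * c ≤ k
    last-hit (suc K) c e with P? K
    ... | no _ = let k , k<K , Pk , le = last-hit K c (trans (sym (+-identityʳ _)) e) in k , <-trans k<K (n<1+n K) , Pk , le
    ... | yes PK with count K in eq
    ...   | zero = K , n<1+n K , PK , ≤-trans (≤-reflexive (trans (cong (d *_) (sym (suc-injective e))) (*-zeroʳ d))) z≤n
    ...   | suc c′ with last-hit K c′ eq
    ...     | k , k<K , Pk , le = K , n<1+n K , PK , (begin
              d * c             ≡⟨ cong (d *_) (suc-injective e) ⟨
              d * (c′ + 1)      ≡⟨ cong (d *_) (+-comm c′ 1) ⟩
              d * suc c′        ≡⟨ *-suc d c′ ⟩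
              d + d * c′        ≤⟨ +-monoʳ-≤ d le ⟩
              d + k             ≡⟨ +-comm d k ⟩
              k + d             ≤⟨ spaced k<K Pk PK ⟩
              K                 ∎)
      where open ≤-Reasoning

  -- There are at most K / d + 1 hits. If there is one at all, then d ≤ M, and M absorbs the extra
  -- hit.
  spaced-count : ∀ K → (∀ k → k < K → P k → d ≤ M) → d * Σ< K (λ k → 𝟙 (P? k)) ≤ K + M
  spaced-count K d≤M with count K in eq
  ... | zero  = ≤-trans (≤-reflexive (*-zeroʳ d)) z≤n
  ... | suc c with k , k<K , Pk , le ← last-hit K c eq = begin
      d * suc c     ≡⟨ *-suc d c ⟩
      d + d * c     ≤⟨ +-mono-≤ (d≤M k k<K Pk) (≤-trans le (<⇒≤ k<K)) ⟩
      M + K         ≡⟨ +-comm M K ⟩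
      K + M         ∎
    where open ≤-Reasoning

-- The number of ways of dividing n successively by u numbers from {3, …, e + 2},
-- in non-increasing order; n = 0 counts as having none.
strips : ℕ → ℕ → ℕ → ℕ
strips e       zero    zero    = 0
strips e       zero    (suc n) = 1
strips zero    (suc u) n       = 0
strips (suc e) (suc u) n       = 𝟙 (3 + e ∣? n) * strips (suc e) u (n / (3 + e)) + strips e (suc u) n

Σ<-multiples : ∀ D → .{{_ : NonZero D}} → ∀ X Y (f : ℕ → ℕ) → X ≤ D * Y →
  Σ< X (λ j → 𝟙 (D ∣? j) * f (j / D)) ≤ Σ< Y f
Σ<-multiples D zero    Y f le = z≤n
Σ<-multiples D (suc X) Y f le with D ∣? X
... | no _ = ≤-trans (≤-reflexive (+-identityʳ _)) (Σ<-multiples D X Y f (≤-trans (n≤1+n X) le))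
... | yes (divides q refl) = begin
    Σ< (q * D) (λ j → 𝟙 (D ∣? j) * f (j / D)) + 1 * f (q * D / D)
      ≤⟨ +-mono-≤ (Σ<-multiples D (q * D) q f (≤-reflexive (*-comm q D))) (≤-reflexive (trans (*-identityˡ _) (cong f (m*n/n≡m q D)))) ⟩
    Σ< q f + f q     ≤⟨ Σ<-extend (*-cancelʳ-< D q Y (subst (q * D <_) (*-comm D Y) le)) f ⟩
    Σ< Y f           ∎
  where open ≤-Reasoning

-- On average over n ≤ x the count is at most the coefficient of z^u in the product of the 1 / (1 -
-- z/d) over 3 ≤ d ≤ e + 2. At z = 2 this product telescopes to (e + 2)(e + 1) / 2, so the
-- coefficient is at most that divided by 2^u. Divisors start at 3 because the factor of d = 2 has a
-- pole at z = 2.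
Σ<-strips : ∀ e u x → 2 ^ suc u * Σ< (suc x) (strips e u) ≤ (2 + e) * (1 + e) * x
Σ<-strips e zero x = begin
  2 * Σ< (suc x) (strips e 0)         ≡⟨ cong (2 *_) (count x) ⟩
  2 * x                               ≤⟨ *-monoˡ-≤ x (*-mono-≤ {2} {2 + e} {1} {1 + e} (s≤s (s≤s z≤n)) (s≤s z≤n)) ⟩
  (2 + e) * (1 + e) * x               ∎
  where
  open ≤-Reasoning
  count : ∀ x → Σ< (suc x) (strips e 0) ≡ x
  count zero    = refl
  count (suc x) = trans (cong (_+ 1) (count x)) (+-comm x 1)
Σ<-strips zero    (suc u) x = ≤-trans (≤-reflexive (trans (cong (2 ^ suc (suc u) *_)
  (trans (Σ<-const (suc x) 0) (*-zeroʳ (suc x)))) (*-zeroʳ (2 ^ suc (suc u))))) z≤n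
Σ<-strips (suc e) (suc u) x = begin
  2 ^ (2 + u) * Σ< (suc x) (strips (suc e) (suc u))
    ≡⟨ cong (2 ^ (2 + u) *_) (Σ<-+ (suc x) (λ n → 𝟙 (D ∣? n) * strips (suc e) u (n / D)) (strips e (suc u))) ⟩
  2 ^ (2 + u) * (Σ< (suc x) (λ n → 𝟙 (D ∣? n) * strips (suc e) u (n / D)) + Σ< (suc x) (strips e (suc u)))
    ≤⟨ *-monoʳ-≤ (2 ^ (2 + u)) (+-monoˡ-≤ _ (Σ<-multiples D (suc x) (suc (x / D)) (strips (suc e) u) x<)) ⟩
  2 ^ (2 + u) * (Σ< (suc (x / D)) (strips (suc e) u) + Σ< (suc x) (strips e (suc u)))
    ≡⟨ split (2 ^ u) (Σ< (suc (x / D)) (strips (suc e) u)) (Σ< (suc x) (strips e (suc u))) ⟩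
  2 * (2 ^ suc u * Σ< (suc (x / D)) (strips (suc e) u)) + 2 ^ (2 + u) * Σ< (suc x) (strips e (suc u))
    ≤⟨ +-mono-≤ (*-monoʳ-≤ 2 (Σ<-strips (suc e) u (x / D))) (Σ<-strips e (suc u) x) ⟩
  2 * ((3 + e) * (2 + e) * (x / D)) + (2 + e) * (1 + e) * x
    ≡⟨ cong (_+ (2 + e) * (1 + e) * x) (regroup e (x / D)) ⟩
  2 * (2 + e) * (x / D * D) + (2 + e) * (1 + e) * x
    ≤⟨ +-monoˡ-≤ _ (*-monoʳ-≤ (2 * (2 + e)) (m/n*n≤m x D)) ⟩
  2 * (2 + e) * x + (2 + e) * (1 + e) * x
    ≡⟨ collect e x ⟩
  (3 + e) * (2 + e) * x ∎
  where
  open ≤-Reasoning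
  D = 3 + e
  x< : suc x ≤ D * suc (x / D)
  x< = begin
    suc x                       ≡⟨ cong suc (m≡m%n+[m/n]*n x D) ⟩
    suc (x % D) + x / D * D     ≤⟨ +-monoˡ-≤ (x / D * D) (m%n<n x D) ⟩
    suc (x / D) * D             ≡⟨ *-comm (suc (x / D)) D ⟩
    D * suc (x / D)             ∎
  split : ∀ w a b → 2 * (2 * w) * (a + b) ≡ 2 * (2 * w * a) + 2 * (2 * w) * b
  split = solve-∀
  regroup : ∀ e y → 2 * ((3 + e) * (2 + e) * y) ≡ 2 * (2 + e) * (y * (3 + e))
  regroup = solve-∀
  collect : ∀ e x → 2 * (2 + e) * x + (2 + e) * (1 + e) * x ≡ (3 + e) * (2 + e) * x
  collect = solve-∀

-- Divide by the candidates from e + 2 downwards, each as often as possible. A chain of u divisions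
-- would be counted by `strips`, so fewer than u occur; their product is A, and R is what remains.
strips-zero : ∀ e u n → .{{_ : NonZero n}} → strips e u n ≡ 0 →
  ∃ λ A → ∃ λ R → n ≡ A * R × A ≤ (2 + e) ^ u × (∀ d → d ∣ R → 3 ≤ d → 2 + e < d)
strips-zero e zero (suc n) ()
strips-zero zero (suc u) n _ = 1 , n , sym (*-identityˡ n) , m^n>0 2 (suc u) , λ d _ 3≤d → 3≤d
strips-zero (suc e) (suc u) n s≡0 with 3 + e ∣? n
... | no D∤n = let A , R , n≡ , A≤ , rough = strips-zero e (suc u) n s≡0 in
    A , R , n≡ , ≤-trans A≤ (^-monoˡ-≤ (suc u) (n≤1+n (2 + e)))
  , λ d d∣R 3≤d → ≤∧≢⇒< (rough d d∣R 3≤d) (λ { refl → D∤n (subst (d ∣_) (sym n≡) (∣n⇒∣m*n A d∣R)) })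
... | yes D∣n = let A , R , n/D≡ , A≤ , rough = strips-zero (suc e) u (n / D) {{n/D≢0}} (trans (sym (*-identityˡ _)) (m+n≡0⇒m≡0 _ s≡0)) in
    A * D , R , trans (trans (sym (m/n*n≡m D∣n)) (cong (_* D) n/D≡)) (swap A R D)
  , ≤-trans (*-monoˡ-≤ D A≤) (≤-reflexive (*-comm (D ^ u) D)) , rough
  where
  D = 3 + e
  n/D≢0 : NonZero (n / D)
  n/D≢0 = ≢-nonZero (λ e₀ → ≢-nonZero⁻¹ n (trans (sym (m/n*n≡m D∣n)) (cong (_* D) e₀)))
  swap : ∀ A R D → A * R * D ≡ A * D * R
  swap = solve-∀

-- Dyadic blocks and the binary logarithm

dyadic : ∀ n → .{{_ : NonZero n}} → ∃ λ i → ∃ λ r → n ≡ 2 ^ i + r × r < 2 ^ i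
dyadic 1 = 0 , 0 , refl , s≤s z≤n
dyadic (suc n@(suc _)) with i , r , e , r< ← dyadic n with suc r <? 2 ^ i
... | yes r+1< = i , suc r , trans (cong suc e) (sym (+-suc (2 ^ i) r)) , r+1<
... | no r+1≮ = suc i , 0 , trans (cong suc e) (trans (sym (+-suc (2 ^ i) r))
    (trans (cong (2 ^ i +_) (≤-antisym r< (≮⇒≥ r+1≮))) (double (2 ^ i)))) , m^n>0 2 (suc i)
  where
  double : ∀ x → x + x ≡ 2 * x + 0
  double = solve-∀

lg : ℕ → ℕ
lg zero    = 0
lg (suc n) = proj₁ (dyadic (suc n))

dyadic-upper : ∀ {n i r} → n ≡ 2 ^ i + r → r < 2 ^ i → n < 2 ^ suc i
dyadic-upper {n} {i} {r} e r< = subst (_< 2 ^ suc i) (sym e)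
  (subst (2 ^ i + r <_) (cong (2 ^ i +_) (sym (+-identityʳ (2 ^ i)))) (+-monoʳ-< (2 ^ i) r<))

2^lg≤ : ∀ n → .{{_ : NonZero n}} → 2 ^ lg n ≤ n
2^lg≤ (suc n) with i , r , e , _ ← dyadic (suc n) = subst (2 ^ i ≤_) (sym e) (m≤m+n (2 ^ i) r)

<2^lg : ∀ n → .{{_ : NonZero n}} → n < 2 ^ suc (lg n)
<2^lg (suc n) with i , r , e , r< ← dyadic (suc n) = dyadic-upper {i = i} e r<

n<2^n : ∀ n → n < 2 ^ n
n<2^n zero    = s≤s z≤n
n<2^n (suc n) = ≤-trans (+-mono-≤ (m^n>0 2 n) (n<2^n n)) (≤-reflexive (cong (2 ^ n +_) (sym (+-identityʳ (2 ^ n)))))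

-- The sieve

-- Chosen so that depth-large and β-large below compare equal powers of 2.
bits depth β : ℕ → ℕ
bits i = 3 * lg i + 12
depth i = 8 * lg i + 33
β i = 2 ^ bits i

Large : ℕ → Set
Large i = 2 ^ 16 ≤ i

-- The polynomial is the left side of `i-large` written in s = lg i, and 16 is the least s at which
-- it does not exceed 2^s. This is the origin of the threshold 2^16 in `Large`.
polynomial≤2^ : ∀ t → 96 * ((16 + t) * (16 + t)) + 814 * (16 + t) + 1732 ≤ 2 ^ (16 + t)
polynomial≤2^ zero    = ≤ᵇ⇒≤ _ _ _
polynomial≤2^ (suc t) = begin
  96 * ((17 + t) * (17 + t)) + 814 * (17 + t) + 1732                     ≤⟨ m≤m+n _ (96 * (t * t) + 3694 * t + 35350) ⟩
  96 * ((17 + t) * (17 + t)) + 814 * (17 + t) + 1732 + (96 * (t * t) + 3694 * t + 35350) ≡⟨ step t ⟩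
  2 * (96 * ((16 + t) * (16 + t)) + 814 * (16 + t) + 1732)               ≤⟨ *-monoʳ-≤ 2 (polynomial≤2^ t) ⟩
  2 ^ (17 + t)                                                           ∎
  where
  open ≤-Reasoning
  step : ∀ t → 96 * ((17 + t) * (17 + t)) + 814 * (17 + t) + 1732 + (96 * (t * t) + 3694 * t + 35350)
             ≡ 2 * (96 * ((16 + t) * (16 + t)) + 814 * (16 + t) + 1732)
  step = solve-∀

module Parameters (i : ℕ) (large : Large i) where

  instance
    i≢0 : NonZero i
    i≢0 = >-nonZero (≤-trans (s≤s z≤n) large)

  s : ℕ
  s = lg i

  16≤s : 16 ≤ s
  16≤s with 16 ≤? s
  ... | yes le = le
  ... | no s≱16 = ⊥-elim (<⇒≱ (<2^lg i) (≤-trans (^-monoʳ-≤ 2 (≰⇒> s≱16)) large))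

  i<2^ : i < 2 ^ suc s
  i<2^ = <2^lg i

  s-polynomial : 96 * (s * s) + 814 * s + 1732 ≤ i
  s-polynomial = ≤-trans (subst (λ x → 96 * (x * x) + 814 * x + 1732 ≤ 2 ^ x) (m+[n∸m]≡n 16≤s) (polynomial≤2^ (s ∸ 16))) (2^lg≤ i)

  i²≤ : 32 * (i * i) ≤ 2 ^ (5 + (suc s + suc s))
  i²≤ = ≤-trans (*-monoʳ-≤ 32 (*-mono-≤ (<⇒≤ i<2^) (<⇒≤ i<2^)))
    (≤-reflexive (trans (cong (32 *_) (sym (^-distribˡ-+-* 2 (suc s) (suc s)))) (sym (^-distribˡ-+-* 2 5 (suc s + suc s)))))

  32i²≤2^i : 32 * (i * i) ≤ 2 ^ i
  32i²≤2^i = ≤-trans i²≤ (^-monoʳ-≤ 2 {5 + (suc s + suc s)} {i} (≤-trans (≤-trans (m≤m+n (5 + (suc s + suc s)) (96 * (s * s) + 812 * s + 1725)) (≤-reflexive (lem s))) s-polynomial))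
    where
    lem : ∀ s → 5 + (suc s + suc s) + (96 * (s * s) + 812 * s + 1725) ≡ 96 * (s * s) + 814 * s + 1732
    lem = solve-∀

  -- 4 β² is what `Σ<-strips` loses against 2^depth, and 32 i² is the saving wanted from the block.
  depth-large : 32 * (i * i) * (4 * (β i * β i)) ≤ 2 ^ depth i
  depth-large = ≤-trans (*-monoˡ-≤ (4 * (β i * β i)) i²≤) (≤-reflexive (trans
    (cong (2 ^ (5 + (suc s + suc s)) *_) (trans (cong (4 *_) (sym (^-distribˡ-+-* 2 (bits i) (bits i)))) (sym (^-distribˡ-+-* 2 2 (bits i + bits i)))))
    (trans (sym (^-distribˡ-+-* 2 (5 + (suc s + suc s)) (2 + (bits i + bits i)))) (cong (2 ^_) (lem s)))))
    where
    lem : ∀ s → 5 + (suc s + suc s) + (2 + ((3 * s + 12) + (3 * s + 12))) ≡ 8 * s + 33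
    lem = solve-∀

  -- Each of the i + 1 blocks for the smaller prime costs at most 16 / β, and the total has to be at
  -- most 1 / (32 i²).
  β-large : 32 * (i * i) * (16 * suc i) ≤ β i
  β-large = ≤-trans (*-mono-≤ i²≤ (*-monoʳ-≤ 16 i<2^)) (≤-reflexive (trans
    (cong (2 ^ (5 + (suc s + suc s)) *_) (sym (^-distribˡ-+-* 2 4 (suc s))))
    (trans (sym (^-distribˡ-+-* 2 (5 + (suc s + suc s)) (4 + suc s))) (cong (2 ^_) (lem s)))))
    where
    lem : ∀ s → 5 + (suc s + suc s) + (4 + suc s) ≡ 3 * s + 12
    lem = solve-∀

  2i≤β : 2 * suc i ≤ β i
  2i≤β = begin
    2 * suc i                        ≤⟨ *-monoˡ-≤ (suc i) {2} {16} (s≤s (s≤s z≤n)) ⟩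
    16 * suc i                       ≤⟨ m≤n*m (16 * suc i) (32 * (i * i)) {{m*n≢0 32 (i * i) {{_}} {{m*n≢0 i i}}}} ⟩
    32 * (i * i) * (16 * suc i)      ≤⟨ β-large ⟩
    β i                              ∎
    where open ≤-Reasoning

  2≤β : 2 ≤ β i
  2≤β = ≤-trans (*-monoʳ-≤ 2 {1} {suc i} (s≤s z≤n)) 2i≤β

  -- Half of i has to cover the binary lengths of A² and of 2 (i + 2), together with the rounding
  -- losses in `R-large`.
  i-large : 2 * (2 * (suc (bits i) * depth i) + s + 8) ≤ i
  i-large = ≤-trans (≤-reflexive (lem s)) s-polynomial
    where
    lem : ∀ s → 2 * (2 * (suc (3 * s + 12) * (8 * s + 33)) + s + 8) ≡ 96 * (s * s) + 814 * s + 1732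
    lem = solve-∀

  2+i≤ : 2 + i ≤ 2 ^ (2 + s)
  2+i≤ = ≤-trans (+-mono-≤ {1} {2 ^ suc s} (m^n>0 2 (suc s)) i<2^)
    (≤-reflexive (cong (2 ^ suc s +_) (sym (+-identityʳ (2 ^ suc s)))))

module Counting (W K : ℕ) .{{W≢0 : NonZero W}} where

  hits : ℕ → ℕ
  hits d = Σ< K (λ k → 𝟙 (d ∣? suc (W * k)))

  -- A divisor d of 1 + W k is coprime to W, so two of its hits differ by a multiple of d.
  hits-spaced : ∀ d {k l} → k < l → d ∣ suc (W * k) → d ∣ suc (W * l) → k + d ≤ l
  hits-spaced d {k} {l} k<l d∣k d∣l = ≤-trans (+-monoʳ-≤ k d≤) (≤-reflexive (m+[n∸m]≡n (<⇒≤ k<l)))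
    where
    d⊥W : Coprime d W
    d⊥W {c} (c∣d , c∣W) = ∣1⇒≡1 (∣m+n∣m⇒∣n (subst (c ∣_) (+-comm 1 (W * k)) (∣-trans c∣d d∣k)) (∣m⇒∣m*n k c∣W))
    d∣W : d ∣ W * (l ∸ k)
    d∣W = ∣m+n∣m⇒∣n (subst (d ∣_) (sym (cong suc (trans (sym (*-distribˡ-+ W k (l ∸ k))) (cong (W *_) (m+[n∸m]≡n (<⇒≤ k<l)))))) d∣l) d∣k
    d≤ : d ≤ l ∸ k
    d≤ = ∣⇒≤ {{>-nonZero (m<n⇒0<n∸m k<l)}} (coprime-divisor d⊥W d∣W)

  hits-small : ∀ d → d ≤ K → d * hits d ≤ 2 * K
  hits-small d d≤K = ≤-trans (spaced-count (λ k → d ∣? suc (W * k)) d K (hits-spaced d) K (λ _ _ _ → d≤K))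
    (≤-reflexive (cong (K +_) (sym (+-identityʳ K))))

  value≤ : ∀ k → k < K → suc (W * k) ≤ W * K
  value≤ k k<K = ≤-trans (+-monoˡ-≤ (W * k) (>-nonZero⁻¹ W)) (≤-trans (≤-reflexive (sym (*-suc W k))) (*-monoʳ-≤ W k<K))

  -- For d > 2 K a single hit already breaks the bound of `hits-small`. The terms are at most W K,
  -- so d has no hit beyond that, and a bound weaker by the factor W holds for all d.
  hits-all : ∀ d → d * hits d ≤ 2 * (W * K)
  hits-all d = ≤-trans (spaced-count (λ k → d ∣? suc (W * k)) d (W * K) (hits-spaced d) K (λ k k<K d∣ → ≤-trans (∣⇒≤ d∣) (value≤ k k<K)))
    (≤-trans (+-monoˡ-≤ (W * K) (m≤n*m K W)) (≤-reflexive (cong (W * K +_) (sym (+-identityʳ (W * K))))))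

  -- Block i is the interval (2^i, 2^(i+1)], so that p − 1 = 2^i + r for a prime p in it.
  element : ℕ → ℕ → ℕ
  element i r = suc (2 ^ i + r)

  blockMultiples : ℕ → ℕ → ℕ
  blockMultiples i ℓ = Σ< (2 ^ i) (λ r → 𝟙 (ℓ ∣? 2 ^ i + r))

  blockMultiples≤ : ∀ i ℓ → ℓ * blockMultiples i ℓ ≤ 4 * 2 ^ i
  blockMultiples≤ i ℓ = ≤-trans
    (spaced-count (λ r → ℓ ∣? 2 ^ i + r) ℓ (2 ^ suc i)
      (λ {k} {l} k<l ℓ∣k ℓ∣l → ≤-trans (+-monoʳ-≤ k (∣⇒≤ {{>-nonZero (m<n⇒0<n∸m k<l)}}
        (∣m+n∣m⇒∣n (subst (ℓ ∣_) (sym (trans (+-assoc (2 ^ i) k (l ∸ k)) (cong (2 ^ i +_) (m+[n∸m]≡n (<⇒≤ k<l))))) ℓ∣l) ℓ∣k)))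
        (≤-reflexive (m+[n∸m]≡n (<⇒≤ k<l))))
      (2 ^ i) (λ k k< ℓ∣ → ≤-trans (∣⇒≤ {{>-nonZero (≤-trans (m^n>0 2 i) (m≤m+n (2 ^ i) k))}} ℓ∣) (<⇒≤ (dyadic-upper {i = i} refl k<))))
    (≤-trans (m≤m+n _ (2 ^ i)) (≤-reflexive (lem (2 ^ i))))
    where
    lem : ∀ x → x + 2 * x + x ≡ 4 * x
    lem = solve-∀

  -- `stripEvent` carries the multiplicity `strips`: a good m only needs it to vanish, and it is the
  -- mean of the multiplicity that can be bounded.
  squareEvent stripEvent : ℕ → ℕ → ℕ → ℕ
  squareEvent i r m = 𝟙 (element i r * element i r ∣? m)
  stripEvent i r m = strips (β i) (depth i) (2 ^ i + r) * 𝟙 (element i r ∣? m)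

  -- Here q = `element h r′`, p = `element i r`, and ℓ = β + 1 + t is a common divisor of q - 1 and
  -- p - 1.
  sharedEvent : ℕ → ℕ → ℕ → ℕ → ℕ → ℕ → ℕ
  sharedEvent i h t r r′ m =
    𝟙 (suc (β i) + t ∣? 2 ^ h + r′) * 𝟙 (suc (β i) + t ∣? 2 ^ i + r) * 𝟙 (element h r′ * element i r ∣? m)

  -- Blocks h ≤ i suffice for a prime q < p, and t < 2^(h + 1) because ℓ divides q - 1.
  pairEvent : ℕ → ℕ → ℕ → ℕ
  pairEvent i r m = Σ< (suc i) (λ h → Σ< (2 ^ suc h) (λ t → Σ< (2 ^ h) (λ r′ → sharedEvent i h t r r′ m)))

  events : ℕ → ℕ → ℕ
  events i m = Σ< (2 ^ i) (λ r → squareEvent i r m + stripEvent i r m + pairEvent i r m)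

  blockTotal : ℕ → ℕ
  blockTotal i = Σ< K (λ k → events i (suc (W * k)))

  -- X will be 2 K or 2 W K, depending on the range of i. The largest moduli are the products q p,
  -- whence the bound 4^(i + 1).
  module Block (i : ℕ) (large : Large i) (X : ℕ) (hits≤ : ∀ d → d ≤ 2 ^ suc i * 2 ^ suc i → d * hits d ≤ X) where
    open Parameters i large
    open ≤-Reasoning

    2^≢0 : ∀ k → NonZero (2 ^ k)
    2^≢0 k = m^n≢0 2 k

    element≤ : ∀ h {r} → r < 2 ^ h → element h r ≤ 2 ^ suc h
    element≤ h {r} r< = dyadic-upper {i = h} refl r<

    element≥ : ∀ h r → 2 ^ h ≤ element h r
    element≥ h r = ≤-trans (m≤m+n (2 ^ h) r) (n≤1+n _)

    1≤2^ : ∀ k → 1 ≤ 2 ^ k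
    1≤2^ k = m^n>0 2 k

    squareTotal stripTotal pairTotal : ℕ
    squareTotal = Σ< (2 ^ i) (λ r → hits (element i r * element i r))
    stripTotal  = Σ< (2 ^ i) (λ r → strips (β i) (depth i) (2 ^ i + r) * hits (element i r))
    pairTotal   = Σ< (suc i) (λ h → Σ< (2 ^ suc h) (λ t → Σ< (2 ^ i) (λ r → Σ< (2 ^ h) (λ r′ →
      𝟙 (suc (β i) + t ∣? 2 ^ h + r′) * 𝟙 (suc (β i) + t ∣? 2 ^ i + r) * hits (element h r′ * element i r)))))

    squareTotal≤ : 32 * (i * i) * squareTotal ≤ X
    squareTotal≤ = ≤-trans (*-monoˡ-≤ squareTotal 32i²≤2^i) (*-cancelˡ-≤ (2 ^ i) {{2^≢0 i}} (begin
      2 ^ i * (2 ^ i * squareTotal)                                            ≡⟨ *-assoc (2 ^ i) (2 ^ i) squareTotal ⟨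
      2 ^ i * 2 ^ i * squareTotal                                              ≡⟨ Σ<-*ˡ (2 ^ i) (2 ^ i * 2 ^ i) _ ⟨
      Σ< (2 ^ i) (λ r → 2 ^ i * 2 ^ i * hits (element i r * element i r))      ≤⟨ Σ<-≤const (2 ^ i) (λ r r< → ≤-trans
          (*-monoˡ-≤ (hits (element i r * element i r)) (*-mono-≤ (element≥ i r) (element≥ i r)))
          (hits≤ (element i r * element i r) (*-mono-≤ (element≤ i r<) (element≤ i r<)))) ⟩
      2 ^ i * X                                                                ∎))

    strips-block : Σ< (2 ^ i) (λ r → strips (β i) (depth i) (2 ^ i + r)) ≤ Σ< (suc (2 ^ suc i)) (strips (β i) (depth i))
    strips-block = begin
      Σ< (2 ^ i) (λ r → strips (β i) (depth i) (2 ^ i + r))   ≤⟨ m≤n+m _ _ ⟩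
      Σ< (2 ^ i) (strips (β i) (depth i)) + Σ< (2 ^ i) (λ r → strips (β i) (depth i) (2 ^ i + r)) ≡⟨ Σ<-split (2 ^ i) (2 ^ i) (strips (β i) (depth i)) ⟨
      Σ< (2 ^ i + 2 ^ i) (strips (β i) (depth i))             ≤⟨ Σ<-extend (≤-trans (≤-reflexive (cong (2 ^ i +_) (sym (+-identityʳ (2 ^ i))))) (n≤1+n _)) _ ⟩
      Σ< (suc (2 ^ suc i)) (strips (β i) (depth i))           ∎

    stripTotal≤ : 32 * (i * i) * stripTotal ≤ X
    stripTotal≤ = *-cancelˡ-≤ (4 * (β i * β i)) {{m*n≢0 4 (β i * β i) {{_}} {{m*n≢0 (β i) (β i) {{2^≢0 (bits i)}} {{2^≢0 (bits i)}}}}}} (begin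
      4 * (β i * β i) * (32 * (i * i) * stripTotal)   ≡⟨ swap (4 * (β i * β i)) (32 * (i * i)) stripTotal ⟩
      32 * (i * i) * (4 * (β i * β i)) * stripTotal   ≤⟨ *-monoˡ-≤ stripTotal depth-large ⟩
      2 ^ depth i * stripTotal                            ≤⟨ *-cancelˡ-≤ (2 ^ suc i) {{2^≢0 (suc i)}} main ⟩
      4 * (β i * β i) * X                             ∎)
      where
      swap : ∀ a b c → a * (b * c) ≡ b * a * c
      swap = solve-∀
      T = Σ< (suc (2 ^ suc i)) (strips (β i) (depth i))
      weighted : 2 ^ i * stripTotal ≤ T * X
      weighted = begin
        2 ^ i * stripTotal        ≡⟨ Σ<-*ˡ (2 ^ i) (2 ^ i) _ ⟨
        Σ< (2 ^ i) (λ r → 2 ^ i * (strips (β i) (depth i) (2 ^ i + r) * hits (element i r)))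
          ≤⟨ Σ<-mono (2 ^ i) (λ r r< → ≤-trans (≤-reflexive (swap′ (2 ^ i) (strips (β i) (depth i) (2 ^ i + r)) (hits (element i r))))
               (*-monoʳ-≤ (strips (β i) (depth i) (2 ^ i + r)) (≤-trans (*-monoˡ-≤ (hits (element i r)) (element≥ i r))
                 (hits≤ (element i r) (≤-trans (element≤ i r<) (m≤m*n (2 ^ suc i) (2 ^ suc i) {{2^≢0 (suc i)}})))))) ⟩
        Σ< (2 ^ i) (λ r → strips (β i) (depth i) (2 ^ i + r) * X)   ≡⟨ Σ<-*ʳ (2 ^ i) X _ ⟩
        Σ< (2 ^ i) (λ r → strips (β i) (depth i) (2 ^ i + r)) * X   ≤⟨ *-monoˡ-≤ X strips-block ⟩
        T * X                                                   ∎
        where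
        swap′ : ∀ a b c → a * (b * c) ≡ b * (a * c)
        swap′ = solve-∀
      alg₁ : ∀ x y z → 2 * x * (y * z) ≡ 2 * y * (x * z)
      alg₁ = solve-∀
      main : 2 ^ suc i * (2 ^ depth i * stripTotal) ≤ 2 ^ suc i * (4 * (β i * β i) * X)
      main = begin
        2 ^ suc i * (2 ^ depth i * stripTotal)        ≡⟨ alg₁ (2 ^ i) (2 ^ depth i) stripTotal ⟩
        2 ^ suc (depth i) * (2 ^ i * stripTotal)      ≤⟨ *-monoʳ-≤ (2 ^ suc (depth i)) weighted ⟩
        2 ^ suc (depth i) * (T * X)                   ≡⟨ *-assoc (2 ^ suc (depth i)) T X ⟨
        2 ^ suc (depth i) * T * X                     ≤⟨ *-monoˡ-≤ X (Σ<-strips (β i) (depth i) (2 ^ suc i)) ⟩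
        (2 + β i) * (1 + β i) * 2 ^ suc i * X     ≤⟨ *-monoˡ-≤ X (*-monoˡ-≤ (2 ^ suc i) (*-mono-≤ (+-monoˡ-≤ (β i) 2≤β) (+-monoˡ-≤ (β i) (1≤2^ (bits i))))) ⟩
        (β i + β i) * (β i + β i) * 2 ^ suc i * X ≡⟨ alg₂ (β i) (2 ^ suc i) X ⟩
        2 ^ suc i * (4 * (β i * β i) * X)         ∎
        where
        alg₂ : ∀ y z x → (y + y) * (y + y) * z * x ≡ z * (4 * (y * y) * x)
        alg₂ = solve-∀

    pairs-with : ℕ → ℕ → ℕ
    pairs-with h t = Σ< (2 ^ i) (λ r → Σ< (2 ^ h) (λ r′ →
      𝟙 (suc (β i) + t ∣? 2 ^ h + r′) * 𝟙 (suc (β i) + t ∣? 2 ^ i + r) * hits (element h r′ * element i r)))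

    pairs-with≤ : ∀ h t → h < suc i → 2 ^ h * 2 ^ i * pairs-with h t ≤ blockMultiples i (suc (β i) + t) * blockMultiples h (suc (β i) + t) * X
    pairs-with≤ h t h≤i = begin
      2 ^ h * 2 ^ i * pairs-with h t
        ≡⟨ trans (sym (Σ<-*ˡ (2 ^ i) (2 ^ h * 2 ^ i) _)) (Σ<-cong (2 ^ i) (λ r _ → sym (Σ<-*ˡ (2 ^ h) (2 ^ h * 2 ^ i) _))) ⟩
      Σ< (2 ^ i) (λ r → Σ< (2 ^ h) (λ r′ → 2 ^ h * 2 ^ i * (p′ r′ * p r * hits (element h r′ * element i r))))
        ≤⟨ Σ<-mono (2 ^ i) (λ r r< → Σ<-mono (2 ^ h) (λ r′ r′< → ≤-trans
             (≤-reflexive (regroup (2 ^ h * 2 ^ i) (p′ r′) (p r) (hits (element h r′ * element i r))))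
             (*-monoʳ-≤ (p r * p′ r′) (≤-trans
               (*-monoˡ-≤ (hits (element h r′ * element i r)) (*-mono-≤ (element≥ h r′) (element≥ i r)))
               (hits≤ (element h r′ * element i r) (*-mono-≤ (≤-trans (element≤ h r′<) (^-monoʳ-≤ 2 h≤i)) (element≤ i r<))))))) ⟩
      Σ< (2 ^ i) (λ r → Σ< (2 ^ h) (λ r′ → p r * p′ r′ * X))
        ≡⟨ Σ<-cong (2 ^ i) (λ r _ → trans (Σ<-*ʳ (2 ^ h) X _) (cong (_* X) (Σ<-*ˡ (2 ^ h) (p r) p′))) ⟩
      Σ< (2 ^ i) (λ r → p r * Σ< (2 ^ h) p′ * X)
        ≡⟨ trans (Σ<-*ʳ (2 ^ i) X _) (cong (_* X) (Σ<-*ʳ (2 ^ i) (Σ< (2 ^ h) p′) p)) ⟩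
      blockMultiples i (suc (β i) + t) * blockMultiples h (suc (β i) + t) * X ∎
      where
      p p′ : ℕ → ℕ
      p r = 𝟙 (suc (β i) + t ∣? 2 ^ i + r)
      p′ r = 𝟙 (suc (β i) + t ∣? 2 ^ h + r)
      regroup : ∀ a x y z → a * (x * y * z) ≡ y * x * (a * z)
      regroup = solve-∀

    -- By `blockMultiples≤` a common factor ℓ contributes at most (4/ℓ)² X, and the sum over ℓ > β
    -- is at most 16 X / β.
    pairTotal-h≤ : ∀ h → h < suc i → β i * Σ< (2 ^ suc h) (pairs-with h) ≤ 16 * X
    pairTotal-h≤ h h≤i = Σ<-inverse-squares (2 ^ suc h) (β i) (16 * X) (pairs-with h)
      (λ t _ → *-cancelˡ-≤ (2 ^ h * 2 ^ i) {{m*n≢0 (2 ^ h) (2 ^ i) {{2^≢0 h}} {{2^≢0 i}}}} (begin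
        2 ^ h * 2 ^ i * ((suc (β i) + t) * (suc (β i) + t) * pairs-with h t)
          ≡⟨ swap (2 ^ h * 2 ^ i) ((suc (β i) + t) * (suc (β i) + t)) (pairs-with h t) ⟩
        (suc (β i) + t) * (suc (β i) + t) * (2 ^ h * 2 ^ i * pairs-with h t)
          ≤⟨ *-monoʳ-≤ ((suc (β i) + t) * (suc (β i) + t)) (pairs-with≤ h t h≤i) ⟩
        (suc (β i) + t) * (suc (β i) + t) * (blockMultiples i (suc (β i) + t) * blockMultiples h (suc (β i) + t) * X)
          ≡⟨ regroup (suc (β i) + t) (blockMultiples i (suc (β i) + t)) (blockMultiples h (suc (β i) + t)) X ⟩
        ((suc (β i) + t) * blockMultiples h (suc (β i) + t)) * ((suc (β i) + t) * blockMultiples i (suc (β i) + t)) * X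
          ≤⟨ *-monoˡ-≤ X (*-mono-≤ (blockMultiples≤ h (suc (β i) + t)) (blockMultiples≤ i (suc (β i) + t))) ⟩
        4 * 2 ^ h * (4 * 2 ^ i) * X    ≡⟨ final (2 ^ h) (2 ^ i) X ⟩
        2 ^ h * 2 ^ i * (16 * X)       ∎))
      where
      swap : ∀ a b c → a * (b * c) ≡ b * (a * c)
      swap = solve-∀
      regroup : ∀ l x y z → l * l * (x * y * z) ≡ (l * y) * (l * x) * z
      regroup = solve-∀
      final : ∀ a b X → 4 * a * (4 * b) * X ≡ a * b * (16 * X)
      final = solve-∀

    pairTotal≤ : 32 * (i * i) * pairTotal ≤ X
    pairTotal≤ = *-cancelˡ-≤ (16 * suc i) (begin
      16 * suc i * (32 * (i * i) * pairTotal)   ≡⟨ swap (16 * suc i) (32 * (i * i)) pairTotal ⟩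
      32 * (i * i) * (16 * suc i) * pairTotal   ≤⟨ *-monoˡ-≤ pairTotal β-large ⟩
      β i * pairTotal                           ≡⟨ Σ<-*ˡ (suc i) (β i) _ ⟨
      Σ< (suc i) (λ h → β i * Σ< (2 ^ suc h) (pairs-with h))  ≤⟨ Σ<-≤const (suc i) pairTotal-h≤ ⟩
      suc i * (16 * X)                          ≡⟨ final (suc i) X ⟩
      16 * suc i * X                            ∎)
      where
      swap : ∀ a b c → a * (b * c) ≡ b * a * c
      swap = solve-∀
      final : ∀ a X → a * (16 * X) ≡ 16 * a * X
      final = solve-∀

    blockTotal-split : blockTotal i ≡ squareTotal + stripTotal + pairTotal
    blockTotal-split = begin-equality
      Σ< K (λ k → Σ< (2 ^ i) (λ r → squareEvent i r (v k) + stripEvent i r (v k) + pairEvent i r (v k)))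
        ≡⟨ Σ<-cong K (λ k _ → trans (Σ<-+ (2 ^ i) (λ r → squareEvent i r (v k) + stripEvent i r (v k)) (λ r → pairEvent i r (v k)))
             (cong (_+ Σ< (2 ^ i) (λ r → pairEvent i r (v k))) (Σ<-+ (2 ^ i) (λ r → squareEvent i r (v k)) (λ r → stripEvent i r (v k))))) ⟩
      Σ< K (λ k → Σ< (2 ^ i) (λ r → squareEvent i r (v k)) + Σ< (2 ^ i) (λ r → stripEvent i r (v k)) + Σ< (2 ^ i) (λ r → pairEvent i r (v k)))
        ≡⟨ trans (Σ<-+ K (λ k → Σ< (2 ^ i) (λ r → squareEvent i r (v k)) + Σ< (2 ^ i) (λ r → stripEvent i r (v k))) (λ k → Σ< (2 ^ i) (λ r → pairEvent i r (v k))))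
             (cong (_+ Σ< K (λ k → Σ< (2 ^ i) (λ r → pairEvent i r (v k))))
               (Σ<-+ K (λ k → Σ< (2 ^ i) (λ r → squareEvent i r (v k))) (λ k → Σ< (2 ^ i) (λ r → stripEvent i r (v k))))) ⟩
      Σ< K (λ k → Σ< (2 ^ i) (λ r → squareEvent i r (v k))) + Σ< K (λ k → Σ< (2 ^ i) (λ r → stripEvent i r (v k))) + Σ< K (λ k → Σ< (2 ^ i) (λ r → pairEvent i r (v k)))
        ≡⟨ cong₂ _+_ (cong₂ _+_ squares stripped) pairs ⟩
      squareTotal + stripTotal + pairTotal ∎
      where
      v : ℕ → ℕ
      v k = suc (W * k)
      squares : Σ< K (λ k → Σ< (2 ^ i) (λ r → squareEvent i r (v k))) ≡ squareTotal
      squares = Σ<-swap K (2 ^ i) (λ k r → squareEvent i r (v k))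
      stripped : Σ< K (λ k → Σ< (2 ^ i) (λ r → stripEvent i r (v k))) ≡ stripTotal
      stripped = trans (Σ<-swap K (2 ^ i) (λ k r → stripEvent i r (v k)))
        (Σ<-cong (2 ^ i) (λ r _ → Σ<-*ˡ K (strips (β i) (depth i) (2 ^ i + r)) (λ k → 𝟙 (element i r ∣? v k))))
      pairs : Σ< K (λ k → Σ< (2 ^ i) (λ r → pairEvent i r (v k))) ≡ pairTotal
      pairs = begin-equality
        Σ< K (λ k → Σ< (2 ^ i) (λ r → Σ< (suc i) (λ h → Σ< (2 ^ suc h) (λ t → Σ< (2 ^ h) (λ r′ → sharedEvent i h t r r′ (v k))))))
          ≡⟨ Σ<-cong K (λ k _ → trans (Σ<-swap (2 ^ i) (suc i) (λ r h → Σ< (2 ^ suc h) (λ t → Σ< (2 ^ h) (λ r′ → sharedEvent i h t r r′ (v k)))))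
               (Σ<-cong (suc i) (λ h _ → Σ<-swap (2 ^ i) (2 ^ suc h) (λ r t → Σ< (2 ^ h) (λ r′ → sharedEvent i h t r r′ (v k)))))) ⟩
        Σ< K (λ k → Σ< (suc i) (λ h → Σ< (2 ^ suc h) (λ t → Σ< (2 ^ i) (λ r → Σ< (2 ^ h) (λ r′ → sharedEvent i h t r r′ (v k))))))
          ≡⟨ trans (Σ<-swap K (suc i) (λ k h → Σ< (2 ^ suc h) (λ t → Σ< (2 ^ i) (λ r → Σ< (2 ^ h) (λ r′ → sharedEvent i h t r r′ (v k))))))
             (Σ<-cong (suc i) (λ h _ → trans (Σ<-swap K (2 ^ suc h) (λ k t → Σ< (2 ^ i) (λ r → Σ< (2 ^ h) (λ r′ → sharedEvent i h t r r′ (v k)))))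
             (Σ<-cong (2 ^ suc h) (λ t _ → trans (Σ<-swap K (2 ^ i) (λ k r → Σ< (2 ^ h) (λ r′ → sharedEvent i h t r r′ (v k))))
             (Σ<-cong (2 ^ i) (λ r _ → trans (Σ<-swap K (2 ^ h) (λ k r′ → sharedEvent i h t r r′ (v k)))
             (Σ<-cong (2 ^ h) (λ r′ _ → Σ<-*ˡ K (𝟙 (suc (β i) + t ∣? 2 ^ h + r′) * 𝟙 (suc (β i) + t ∣? 2 ^ i + r)) (λ k → 𝟙 (element h r′ * element i r ∣? v k)))))))))) ⟩
        pairTotal ∎

    blockTotal≤ : i * i * (32 * blockTotal i) ≤ 3 * X
    blockTotal≤ = begin
      i * i * (32 * blockTotal i)                            ≡⟨ cong (λ z → i * i * (32 * z)) blockTotal-split ⟩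
      i * i * (32 * (squareTotal + stripTotal + pairTotal))  ≡⟨ distr (i * i) squareTotal stripTotal pairTotal ⟩
      32 * (i * i) * squareTotal + 32 * (i * i) * stripTotal + 32 * (i * i) * pairTotal
        ≤⟨ +-mono-≤ (+-mono-≤ squareTotal≤ stripTotal≤) pairTotal≤ ⟩
      X + X + X                                              ≡⟨ three X ⟩
      3 * X                                                  ∎
      where
      distr : ∀ j x y z → j * (32 * (x + y + z)) ≡ 32 * j * x + 32 * j * y + 32 * j * z
      distr = solve-∀
      three : ∀ x → x + x + x ≡ 3 * x
      three = solve-∀

-- Since 2 ≤ e, the number 4 is among the excluded divisors, so R has at most one factor 2; moving
-- it into A doubles the bound.
remove-two : ∀ {n A R M e} → n ≡ A * R → A ≤ M → 2 ≤ e → (∀ d → d ∣ R → 3 ≤ d → 2 + e < d) →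
  ∃ λ A′ → ∃ λ R′ → n ≡ A′ * R′ × A′ ≤ 2 * M × (∀ d → d ∣ R′ → 1 < d → 2 + e < d)
remove-two {n} {A} {R} {M} {e} n≡ A≤ 2≤e rough with 2 ∣? R
... | no 2∤R = A , R , n≡ , ≤-trans A≤ (m≤n*m M 2) , rough′
  where
  rough′ : ∀ d → d ∣ R → 1 < d → 2 + e < d
  rough′ d d∣R 1<d with d ≟ 2
  ... | yes refl = ⊥-elim (2∤R d∣R)
  ... | no d≢2 = rough d d∣R (≤∧≢⇒< 1<d (d≢2 ∘ sym))
... | yes (divides q refl) = A * 2 , q , trans n≡ (shuffle A q) , ≤-trans (*-monoˡ-≤ 2 A≤) (≤-reflexive (*-comm M 2)) , rough′
  where
  shuffle : ∀ A q → A * (q * 2) ≡ A * 2 * q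
  shuffle = solve-∀
  rough′ : ∀ d → d ∣ q → 1 < d → 2 + e < d
  rough′ d d∣q 1<d with d ≟ 2
  ... | yes refl = ⊥-elim (<⇒≱ (rough 4 (*-pres-∣ d∣q (∣-refl {2})) (s≤s (s≤s (s≤s z≤n)))) (+-monoʳ-≤ 2 2≤e))
  ... | no d≢2 = rough d (∣m⇒∣m*n 2 d∣q) (≤∧≢⇒< 1<d (d≢2 ∘ sym))

record RoughFactorisation (i n : ℕ) : Set where
  field
    A R   : ℕ
    n≡AR  : n ≡ A * R
    A≤    : A ≤ 2 * (2 + β i) ^ depth i
    rough : ∀ d → d ∣ R → 1 < d → 2 + β i < d

rough-factorisation : ∀ i n → .{{_ : NonZero n}} → 2 ≤ β i → strips (β i) (depth i) n ≡ 0 → RoughFactorisation i n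
rough-factorisation i n 2≤β e
  with A , R , n≡ , A≤ , rough ← strips-zero (β i) (depth i) n e
  with A′ , R′ , n≡′ , A′≤ , rough′ ← remove-two n≡ A≤ 2≤β rough =
  record { A = A′ ; R = R′ ; n≡AR = n≡′ ; A≤ = A′≤ ; rough = rough′ }

2^-cancel-≤ : ∀ {x y} → 2 ^ x ≤ 2 ^ y → x ≤ y
2^-cancel-≤ {x} {y} le with x ≤? y
... | yes x≤y = x≤y
... | no x≰y = ⊥-elim (<⇒≱ (^-monoʳ-< 2 (s≤s (s≤s z≤n)) (≰⇒> x≰y)) le)

module BlockPrime (i : ℕ) (large : Large i) (n r : ℕ) (n≡ : n ≡ 2 ^ i + r) (r< : r < 2 ^ i)
                  (A R : ℕ) (n≡AR : n ≡ A * R) (A≤ : A ≤ 2 * (2 + β i) ^ depth i) where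
  open Parameters i large
  open ≤-Reasoning

  -- The exponent of 2 in Z is 3 (i + 1) / 2 rounded up, so that Z² ≥ p³ throughout the block.
  v Z : ℕ
  v = suc ⌊ i /2⌋
  Z = 2 ^ suc i * 2 ^ v

  n<2^ : n < 2 ^ suc i
  n<2^ = dyadic-upper {i = i} n≡ r<

  half+half : ⌊ i /2⌋ + ⌊ i /2⌋ ≤ i
  half+half = ≤-trans (+-monoʳ-≤ ⌊ i /2⌋ (⌊n/2⌋≤⌈n/2⌉ i)) (≤-reflexive (⌊n/2⌋+⌈n/2⌉≡n i))

  1+i≤2v : suc i ≤ v + v
  1+i≤2v = begin
    suc i                          ≡⟨ cong suc (⌊n/2⌋+⌈n/2⌉≡n i) ⟨
    suc (⌊ i /2⌋ + ⌊ suc i /2⌋)    ≤⟨ s≤s (+-monoʳ-≤ ⌊ i /2⌋ (⌊n/2⌋-mono (n≤1+n (suc i)))) ⟩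
    v + v                          ∎

  cube≤ : suc n * suc n * suc n ≤ Z * Z
  cube≤ = begin
    suc n * suc n * suc n                        ≤⟨ *-mono-≤ (*-mono-≤ n<2^ n<2^) n<2^ ⟩
    P * P * P                                    ≤⟨ *-monoʳ-≤ (P * P) (^-monoʳ-≤ 2 1+i≤2v) ⟩
    P * P * 2 ^ (v + v)                          ≡⟨ cong (P * P *_) (^-distribˡ-+-* 2 v v) ⟩
    P * P * (2 ^ v * 2 ^ v)                      ≡⟨ regroup P (2 ^ v) ⟩
    Z * Z                                        ∎
    where
    P = 2 ^ suc i
    regroup : ∀ P V → P * P * (V * V) ≡ P * V * (P * V)
    regroup = solve-∀

  a : ℕ
  a = suc (suc (bits i) * depth i)

  A≤2^ : A ≤ 2 ^ a
  A≤2^ = begin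
    A                              ≤⟨ A≤ ⟩
    2 * (2 + β i) ^ depth i            ≤⟨ *-monoʳ-≤ 2 (^-monoˡ-≤ (depth i) (+-mono-≤ 2≤β (≤-reflexive (sym (+-identityʳ (β i)))))) ⟩
    2 * (2 ^ suc (bits i)) ^ depth i      ≡⟨ cong (2 *_) (^-*-assoc 2 (suc (bits i)) (depth i)) ⟩
    2 ^ a                          ∎

  -- From n = A R and n ≥ 2^i, R² is at least 4^i / A², whereas Z is about 2^(3 i / 2). The exponent
  -- of A² and the logarithm of i have to fit into the remaining i / 2, which is `half-large`.
  R-large : 2 * suc (suc i) * Z < R * R
  R-large with 2 * suc (suc i) * Z <? R * R
  ... | yes lt = lt
  ... | no R²≤ = ⊥-elim (<⇒≱ contradiction′ (2^-cancel-≤ {i + i} {(a + a) + (1 + (2 + s) + (suc i + v))} powers))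
    where
    powers : 2 ^ (i + i) ≤ 2 ^ ((a + a) + (1 + (2 + s) + (suc i + v)))
    powers = begin
      2 ^ (i + i)                                             ≡⟨ ^-distribˡ-+-* 2 i i ⟩
      2 ^ i * 2 ^ i                                           ≤⟨ *-mono-≤ 2^i≤n 2^i≤n ⟩
      n * n                                                   ≡⟨ cong₂ _*_ n≡AR n≡AR ⟩
      A * R * (A * R)                                         ≡⟨ interchange A R ⟩
      A * A * (R * R)                                         ≤⟨ *-mono-≤ (*-mono-≤ A≤2^ A≤2^) (≮⇒≥ R²≤) ⟩
      2 ^ a * 2 ^ a * (2 * suc (suc i) * Z)                   ≤⟨ *-monoʳ-≤ (2 ^ a * 2 ^ a) (*-monoˡ-≤ Z (*-monoʳ-≤ 2 2+i≤)) ⟩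
      2 ^ a * 2 ^ a * (2 ^ (1 + (2 + s)) * Z)
        ≡⟨ cong₂ _*_ (^-distribˡ-+-* 2 a a) (trans (^-distribˡ-+-* 2 (1 + (2 + s)) (suc i + v)) (cong (2 ^ (1 + (2 + s)) *_) (^-distribˡ-+-* 2 (suc i) v))) ⟨
      2 ^ (a + a) * 2 ^ (1 + (2 + s) + (suc i + v))           ≡⟨ ^-distribˡ-+-* 2 (a + a) (1 + (2 + s) + (suc i + v)) ⟨
      2 ^ ((a + a) + (1 + (2 + s) + (suc i + v)))             ∎
      where
      2^i≤n : 2 ^ i ≤ n
      2^i≤n = subst (2 ^ i ≤_) (sym n≡) (m≤m+n (2 ^ i) r)
      interchange : ∀ A R → A * R * (A * R) ≡ A * A * (R * R)
      interchange = solve-∀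
    half-large : 2 * (suc (bits i) * depth i) + s + 8 ≤ ⌊ i /2⌋
    half-large = ≤-trans (≤-reflexive (n≡⌊n+n/2⌋ c)) (⌊n/2⌋-mono (≤-trans (≤-reflexive (cong (c +_) (sym (+-identityʳ c)))) i-large))
      where c = 2 * (suc (bits i) * depth i) + s + 8
    contradiction′ : (a + a) + (1 + (2 + s) + (suc i + v)) < i + i
    contradiction′ = begin-strict
      (a + a) + (1 + (2 + s) + (suc i + v))                       <⟨ n<1+n _ ⟩
      suc ((a + a) + (1 + (2 + s) + (suc i + v)))                 ≡⟨ regroup (suc (bits i) * depth i) s i ⌊ i /2⌋ ⟩
      2 * (suc (bits i) * depth i) + s + 8 + ⌊ i /2⌋ + i                 ≤⟨ +-monoˡ-≤ i (+-monoˡ-≤ ⌊ i /2⌋ half-large) ⟩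
      ⌊ i /2⌋ + ⌊ i /2⌋ + i                                       ≤⟨ +-monoˡ-≤ i half+half ⟩
      i + i                                                       ∎
      where
      regroup : ∀ x s i h → suc ((suc x + suc x) + (1 + (2 + s) + (suc i + suc h))) ≡ 2 * x + s + 8 + h + i
      regroup = solve-∀

  R≢0 : NonZero R
  R≢0 = ≢-nonZero λ { refl → <⇒≱ R-large z≤n }

distinct-primes-∣ : ∀ {p q m} → Prime p → Prime q → q < p → p ∣ m → q ∣ m → q * p ∣ m
distinct-primes-∣ {p} {q} pp pq q<p (divides c refl) q∣m with euclidsLemma c p pq q∣m
... | inj₁ q∣c = *-pres-∣ q∣c ∣-refl
... | inj₂ q∣p with prime⇒irreducible pp q∣p
...   | inj₁ refl = ⊥-elim (¬prime[1] pq)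
...   | inj₂ refl = ⊥-elim (<-irrefl refl q<p)

-- From a bound for the total badness to lower density

module Select (W : ℕ) .{{_ : NonZero W}} (bad : ℕ → ℕ) where

  select : ℕ → List ℕ
  select zero = []
  select (suc k) with bad k ≟ 0
  ... | yes _ = suc (W * k) ∷ select k
  ... | no _  = select k

  next : ∀ k {x} → x < suc (W * k) → x < suc (W * suc k)
  next k lt = <-trans lt (s≤s (*-monoʳ-< W (n<1+n k)))

  select< : ∀ k → All (_< suc (W * k)) (select k)
  select< zero = []
  select< (suc k) with bad k ≟ 0
  ... | yes _ = s≤s (*-monoʳ-< W (n<1+n k)) ∷ All.map (next k) (select< k)
  ... | no _  = All.map (next k) (select< k)

  select-unique : ∀ k → Unique (select k)
  select-unique zero = []
  select-unique (suc k) with bad k ≟ 0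
  ... | yes _ = All.map (λ lt e → <⇒≢ lt (sym e)) (select< k) ∷ select-unique k
  ... | no _  = select-unique k

  select-All : ∀ {P : ℕ → Set} K → (∀ k → k < K → bad k ≡ 0 → P (suc (W * k))) → All P (select K)
  select-All zero    _ = []
  select-All (suc K) h with bad K ≟ 0
  ... | yes clean = h K (n<1+n K) clean ∷ select-All K (λ k k<K → h k (<-trans k<K (n<1+n K)))
  ... | no _      = select-All K (λ k k<K → h k (<-trans k<K (n<1+n K)))

  -- A rejected k adds at least 1 to the sum of `bad`.
  select-length : ∀ k → k ≤ length (select k) + Σ< k bad
  select-length zero = z≤n
  select-length (suc k) with bad k ≟ 0
  ... | yes _ = s≤s (≤-trans (select-length k) (+-monoʳ-≤ (length (select k)) (m≤m+n _ _)))
  ... | no ≢0 = ≤-trans (≤-trans (≤-reflexive (+-comm 1 k)) (+-mono-≤ (select-length k) (n≢0⇒n>0 ≢0)))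
      (≤-reflexive (+-assoc (length (select k)) _ _))

  -- At most 12/32 = 3/8 of the terms are rejected.
  select-half : ∀ K → 32 * Σ< K bad ≤ 12 * K → K ≤ 2 * length (select K)
  select-half K few = *-cancelˡ-≤ 16 (+-cancelʳ-≤ (16 * K) _ _ (begin
    16 * K + 16 * K                            ≡⟨ double K ⟩
    32 * K                                     ≤⟨ *-monoʳ-≤ 32 (select-length K) ⟩
    32 * (length (select K) + Σ< K bad)        ≡⟨ *-distribˡ-+ 32 (length (select K)) _ ⟩
    32 * length (select K) + 32 * Σ< K bad     ≤⟨ +-monoʳ-≤ (32 * length (select K)) few ⟩
    32 * length (select K) + 12 * K            ≤⟨ +-mono-≤ (≤-reflexive (half (length (select K)))) (*-monoˡ-≤ K (≤ᵇ⇒≤ 12 16 _)) ⟩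
    16 * (2 * length (select K)) + 16 * K      ∎))
    where
    open ≤-Reasoning
    double : ∀ K → 16 * K + 16 * K ≡ 32 * K
    double = solve-∀
    half : ∀ l → 32 * l ≡ 16 * (2 * l)
    half = solve-∀

-- `bad` may depend on K because the range of primes to be sieved grows with N. With K = N / W at
-- least half of the K terms survive, and rounding costs at most another factor 2 as K ≥ 1, whence
-- the density 1 / (4 W).
density-of-progression : ∀ {P : ℕ → Set} W → .{{_ : NonZero W}} → ∀ K₀ → 1 ≤ K₀ → (bad : ℕ → ℕ → ℕ) →
  (∀ K → K₀ ≤ K → 32 * Σ< K (bad K) ≤ 12 * K) →
  (∀ K k → k < K → bad K k ≡ 0 → P (suc (W * k))) → PositiveLowerDensity P
density-of-progression {P} W K₀ 1≤K₀ bad few clean = 1 , 4 * W , ≤-refl , *-mono-≤ {1} {4} (s≤s z≤n) (>-nonZero⁻¹ W) , W * K₀ , witness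
  where
  module _ (N : ℕ) (N₀≤N : W * K₀ ≤ N) where
    K : ℕ
    K = N / W
    open Select W (bad K)
    K-large : K₀ ≤ K
    K-large = ≤-trans (≤-reflexive (sym (trans (cong (_/ W) (*-comm W K₀)) (m*n/n≡m K₀ W)))) (/-monoˡ-≤ W N₀≤N)
    WK≤N : W * K ≤ N
    WK≤N = ≤-trans (≤-reflexive (*-comm W K)) (m/n*n≤m N W)
    value≤N : ∀ k → k < K → suc (W * k) ≤ N
    value≤N k k<K = ≤-trans (+-monoˡ-≤ (W * k) (>-nonZero⁻¹ W)) (≤-trans (≤-reflexive (sym (*-suc W k))) (≤-trans (*-monoʳ-≤ W k<K) WK≤N))
    l = length (select K)
    K≤2l : K ≤ 2 * l
    K≤2l = select-half K (few K K-large)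
    count : 1 * N ≤ 4 * W * l
    count = begin
      1 * N                 ≡⟨ *-identityˡ N ⟩
      N                     ≡⟨ m≡m%n+[m/n]*n N W ⟩
      N % W + K * W         ≤⟨ +-monoˡ-≤ (K * W) (m%n≤n N W) ⟩
      suc K * W             ≤⟨ *-monoˡ-≤ W (+-monoˡ-≤ K (≤-trans 1≤K₀ K-large)) ⟩
      (K + K) * W           ≤⟨ *-monoˡ-≤ W (+-mono-≤ K≤2l K≤2l) ⟩
      (2 * l + 2 * l) * W   ≡⟨ regroup W l ⟩
      4 * W * l             ∎
      where
      open ≤-Reasoning
      regroup : ∀ W l → (2 * l + 2 * l) * W ≡ 4 * W * l
      regroup = solve-∀
    witness : Σ (List ℕ) λ xs → Unique xs × All (λ m → 1 ≤ m × m ≤ N × P m) xs × (1 * N ≤ 4 * W * length xs)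
    witness = select K , select-unique K , select-All K (λ k k<K e → s≤s z≤n , value≤N k k<K , clean K k k<K e) , count

-- W is divisible by every positive d ≤ 2^i₀ + 1, so the primes dividing 1 + W k lie in blocks of
-- index at least i₀, where the estimates hold. Writing i₀ = b₀ + 1 fits the bound 1/b₀ for the tail
-- of Σ 1/i².
module Sieve (b₀ : ℕ) (large₀ : Large (suc b₀)) where

  i₀ W : ℕ
  i₀ = suc b₀
  W  = suc (2 ^ i₀) !

  instance
    W≢0 : NonZero W
    W≢0 = suc (2 ^ i₀) !≢0

  large : ∀ y → Large (i₀ + y)
  large y = ≤-trans large₀ (m≤m+n i₀ y)

  module Range (K : ℕ) where
    open Counting W K

    -- Every block containing a prime divisor of m is included, since its index satisfies i < 2^i <
    -- m ≤ W K. The additional W blocks prepare the splitting in `totalBadness`.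
    badness : ℕ → ℕ
    badness k = Σ< (W + W * K) (λ y → events (i₀ + y) (suc (W * k)))

    -- In the first W blocks all moduli are at most K, so X = 2 K. Beyond them X = 2 W K, but there
    -- the tail of Σ 1/i² is at most 1 / (b₀ + W), which pays for the factor W. Each range
    -- contributes at most 3 (2 K).
    totalBadness : 2 ^ (i₀ + W) * 2 ^ (i₀ + W) ≤ K → 32 * Σ< K badness ≤ 12 * K
    totalBadness K-large = begin
      32 * Σ< K badness
        ≡⟨ cong (32 *_) (Σ<-swap K (W + W * K) (λ k y → events (i₀ + y) (suc (W * k)))) ⟩
      32 * Σ< (W + W * K) (λ y → blockTotal (i₀ + y))                       ≡⟨ Σ<-*ˡ (W + W * K) 32 _ ⟨
      Σ< (W + W * K) (λ y → 32 * blockTotal (i₀ + y))                       ≡⟨ Σ<-split W (W * K) _ ⟩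
      Σ< W (λ y → 32 * blockTotal (i₀ + y)) + Σ< (W * K) far                ≤⟨ +-mono-≤ near≤ far≤ ⟩
      3 * (2 * K) + 3 * (2 * K)                                             ≡⟨ total K ⟩
      12 * K                                                                ∎
      where
      open ≤-Reasoning
      total : ∀ K → 3 * (2 * K) + 3 * (2 * K) ≡ 12 * K
      total = solve-∀
      b₀≢0 : NonZero b₀
      b₀≢0 = >-nonZero (≤-trans (s≤s z≤n) (s≤s⁻¹ (≤-trans (≤ᵇ⇒≤ 2 (2 ^ 16) _) large₀)))
      near≤ : Σ< W (λ y → 32 * blockTotal (i₀ + y)) ≤ 3 * (2 * K)
      near≤ = ≤-trans (m≤n*m _ b₀ {{b₀≢0}}) (Σ<-inverse-squares W b₀ (3 * (2 * K)) _
        (λ y y<W → Block.blockTotal≤ (i₀ + y) (large y) (2 * K) (λ d d≤ → hits-small d (≤-trans d≤ (≤-trans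
          (*-mono-≤ (^-monoʳ-≤ 2 (bound y y<W)) (^-monoʳ-≤ 2 (bound y y<W))) K-large)))))
        where
        bound : ∀ y → y < W → suc (i₀ + y) ≤ i₀ + W
        bound y y<W = ≤-trans (≤-reflexive (sym (+-suc i₀ y))) (+-monoʳ-≤ i₀ y<W)
      far : ℕ → ℕ
      far y = 32 * blockTotal (i₀ + (W + y))
      far≤ : Σ< (W * K) far ≤ 3 * (2 * K)
      far≤ = *-cancelˡ-≤ W (begin
        W * Σ< (W * K) far           ≤⟨ *-monoˡ-≤ (Σ< (W * K) far) (m≤n+m W b₀) ⟩
        (b₀ + W) * Σ< (W * K) far    ≤⟨ Σ<-inverse-squares (W * K) (b₀ + W) (3 * (2 * (W * K))) far
             (λ y _ → subst (λ j → j * j * far y ≤ 3 * (2 * (W * K))) (sym (cong suc (+-assoc b₀ W y)))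
               (Block.blockTotal≤ (i₀ + (W + y)) (large (W + y)) (2 * (W * K)) (λ d _ → hits-all d))) ⟩
        3 * (2 * (W * K))            ≡⟨ swap W K ⟩
        W * (3 * (2 * K))            ∎)
        where
        swap : ∀ W K → 3 * (2 * (W * K)) ≡ W * (3 * (2 * K))
        swap = solve-∀

    module Survivor (k : ℕ) (k<K : k < K) (clean : badness k ≡ 0) where

      m : ℕ
      m = suc (W * k)

      ∣W⇒∤m : ∀ {d} → 1 < d → d ∣ W → ¬ d ∣ m
      ∣W⇒∤m {d} 1<d d∣W d∣m = <⇒≢ 1<d (sym (∣1⇒≡1 (∣m+n∣m⇒∣n (subst (d ∣_) (+-comm 1 (W * k)) d∣m) (∣m⇒∣m*n k d∣W))))

      small∣W : ∀ {d} → .{{_ : NonZero d}} → d ≤ suc (2 ^ i₀) → d ∣ W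
      small∣W {suc d} le = ∣-trans (m∣m*n (d !)) (m≤n⇒m!∣n! le)

      record InBlock (n : ℕ) : Set where
        field
          y r    : ℕ
          split  : n ≡ 2 ^ (i₀ + y) + r
          r<     : r < 2 ^ (i₀ + y)
          y<     : y < W + W * K

      abstract
        inBlock : ∀ n → Prime (suc n) → suc n ∣ m → InBlock n
        inBlock n pn n∣m with dyadic n {{>-nonZero (s≤s⁻¹ (nonTrivial⇒n>1 (suc n) {{prime⇒nonTrivial pn}}))}}
        ... | i , r , e , r< = record { y = i ∸ i₀ ; r = r ; split = trans e (cong (λ j → 2 ^ j + r) (sym i≡))
                                      ; r< = subst (λ j → r < 2 ^ j) (sym i≡) r< ; y< = y<′ }
          where
          i₀≤i : i₀ ≤ i
          i₀≤i with i₀ ≤? i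
          ... | yes le = le
          ... | no i₀≰i = ⊥-elim (∣W⇒∤m (nonTrivial⇒n>1 (suc n) {{prime⇒nonTrivial pn}})
              (small∣W (s≤s (≤-trans (<⇒≤ (dyadic-upper {i = i} e r<)) (^-monoʳ-≤ 2 (≰⇒> i₀≰i))))) n∣m)
          i≡ : i₀ + (i ∸ i₀) ≡ i
          i≡ = m+[n∸m]≡n i₀≤i
          y<′ : i ∸ i₀ < W + W * K
          y<′ = begin-strict
            i ∸ i₀       ≤⟨ m∸n≤m i i₀ ⟩
            i            <⟨ n<2^n i ⟩
            2 ^ i        ≤⟨ m≤m+n (2 ^ i) r ⟩
            2 ^ i + r    ≡⟨ e ⟨
            n            ≤⟨ n≤1+n n ⟩
            suc n        ≤⟨ ∣⇒≤ n∣m ⟩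
            m            ≤⟨ value≤ k k<K ⟩
            W * K        ≤⟨ m≤n+m (W * K) W ⟩
            W + W * K    ∎
            where open ≤-Reasoning

      no-event : ∀ {y r} → y < W + W * K → r < 2 ^ (i₀ + y) →
        squareEvent (i₀ + y) r m + stripEvent (i₀ + y) r m + pairEvent (i₀ + y) r m ≡ 0
      no-event {y} {r} y< r< = n≤0⇒n≡0 (≤-trans (term≤Σ< r< (λ r → squareEvent (i₀ + y) r m + stripEvent (i₀ + y) r m + pairEvent (i₀ + y) r m))
        (≤-trans (term≤Σ< y< (λ y → events (i₀ + y) m)) (≤-reflexive clean)))

      squarefree : ∀ {ℓ} → Prime ℓ → ℓ ∣ m → ¬ ℓ * ℓ ∣ m
      squarefree {zero}  pℓ ℓ∣m = ⊥-elim (¬prime[0] pℓ)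
      squarefree {suc n} pn n∣m n²∣m = 1+n≢0 (trans (sym (𝟙-yes (element (i₀ + y) r * element (i₀ + y) r ∣? m)
          (subst (λ z → suc z * suc z ∣ m) split n²∣m))) (m+n≡0⇒m≡0 _ (m+n≡0⇒m≡0 _ (no-event y< r<))))
        where open InBlock (inBlock n pn n∣m)

      module PrimeDivisor (n : ℕ) (pn : Prime (suc n)) (n∣m : suc n ∣ m) where
        open InBlock (inBlock n pn n∣m) public

        i : ℕ
        i = i₀ + y

        open Parameters i (large y) using (2i≤β; 2≤β)

        no-strips : strips (β i) (depth i) n ≡ 0
        no-strips = trans (cong (strips (β i) (depth i)) split) (trans (sym (*-identityʳ _))
          (trans (cong (strips (β i) (depth i) (2 ^ i + r) *_) (sym (𝟙-yes (element i r ∣? m) (subst (λ z → suc z ∣ m) split n∣m))))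
            (m+n≡0⇒n≡0 (squareEvent i r m) (m+n≡0⇒m≡0 _ (no-event y< r<)))))

        n≢0 : NonZero n
        n≢0 = >-nonZero (s≤s⁻¹ (nonTrivial⇒n>1 (suc n) {{prime⇒nonTrivial pn}}))

        abstract
          factorisation : RoughFactorisation i n
          factorisation = rough-factorisation i n {{n≢0}} 2≤β no-strips

        open RoughFactorisation factorisation public
        open BlockPrime i (large y) n r split r< A R n≡AR A≤ public using (Z; n<2^; cube≤; R-large; R≢0)

        solvable-here : Solvable n R
        solvable-here = solvable n pn A R (β i) i Z {{R≢0}} {{m^n≢0 2 (bits i)}} n≡AR
          (λ d d∣R 1<d → ≤-trans (m≤n+m (β i) 2) (<⇒≤ (rough d d∣R 1<d))) n<2^ 2i≤β cube≤ R-large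

      module PrimePair (n : ℕ) (pn : Prime (suc n)) (n∣m : suc n ∣ m) (l : ℕ) (pl : Prime (suc l)) (l∣m : suc l ∣ m) (l<n : l < n) where
        open PrimeDivisor n pn n∣m
        module Q = PrimeDivisor l pl l∣m

        h r′ : ℕ
        h = Q.i
        r′ = Q.r

        h<1+i : h < suc i
        h<1+i = ≰⇒> (λ i<h → <⇒≱ (<-trans l<n n<2^) (≤-trans (^-monoʳ-≤ 2 i<h) (subst (2 ^ h ≤_) (sym Q.split) (m≤m+n (2 ^ h) r′))))

        no-shared : ∀ t → t < 2 ^ suc h → sharedEvent i h t r r′ m ≡ 0
        no-shared t t< = n≤0⇒n≡0 (begin
          sharedEvent i h t r r′ m                              ≤⟨ term≤Σ< Q.r< (λ r′ → sharedEvent i h t r r′ m) ⟩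
          Σ< (2 ^ h) (λ r′ → sharedEvent i h t r r′ m)          ≤⟨ term≤Σ< t< (λ t → Σ< (2 ^ h) (λ r′ → sharedEvent i h t r r′ m)) ⟩
          Σ< (2 ^ suc h) (λ t → Σ< (2 ^ h) (λ r′ → sharedEvent i h t r r′ m))
            ≤⟨ term≤Σ< h<1+i (λ h → Σ< (2 ^ suc h) (λ t → Σ< (2 ^ h) (λ r′ → sharedEvent i h t r r′ m))) ⟩
          pairEvent i r m                                       ≡⟨ m+n≡0⇒n≡0 (squareEvent i r m + stripEvent i r m) (no-event y< r<) ⟩
          0                                                     ∎)
          where open ≤-Reasoning

        -- As a divisor of R above 1, d exceeds β + 2, so it has the form β + 1 + t and would be
        -- recorded by `sharedEvent`.
        no-common : ∀ d → d ∣ l → d ∣ R → ¬ 1 < d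
        no-common d d∣l d∣R 1<d = 1+n≢0 (trans (sym one) (no-shared t t<))
          where
          t = d ∸ suc (β i)
          d≡ : suc (β i) + t ≡ d
          d≡ = m+[n∸m]≡n (≤-trans (s≤s (m≤n+m (β i) 2)) (rough d d∣R 1<d))
          t< : t < 2 ^ suc h
          t< = ≤-<-trans (≤-trans (m∸n≤m d (suc (β i))) (∣⇒≤ {{Q.n≢0}} d∣l)) Q.n<2^
          one : sharedEvent i h t r r′ m ≡ 1
          one = cong₂ _*_ (cong₂ _*_
              (𝟙-yes (suc (β i) + t ∣? 2 ^ h + r′) (subst₂ _∣_ (sym d≡) Q.split d∣l))
              (𝟙-yes (suc (β i) + t ∣? 2 ^ i + r) (subst₂ _∣_ (sym d≡) (trans (sym n≡AR) split) (∣n⇒∣m*n A d∣R))))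
              (𝟙-yes (element h r′ * element i r ∣? m) (subst₂ (λ z w → suc z * suc w ∣ m) Q.split split
                (distinct-primes-∣ pn pl (s≤s l<n) n∣m l∣m)))

        independent : Coprime l R
        independent {zero}        (0∣l , _)   = ⊥-elim (≢-nonZero⁻¹ l {{Q.n≢0}} (0∣⇒≡0 0∣l))
        independent {suc zero}    _           = refl
        independent {suc (suc d)} (d∣l , d∣R) = ⊥-elim (no-common (suc (suc d)) d∣l d∣R (s≤s (s≤s z≤n)))

      local : ∀ n → Prime (suc n) → suc n ∣ m → ∃ λ R → Solvable n R ×
        (∀ l → Prime (suc l) → suc l ∣ m → l < n → Coprime l R)
      local n pn n∣m = PrimeDivisor.R n pn n∣m , PrimeDivisor.solvable-here n pn n∣m
        , λ l pl l∣m l<n → PrimePair.independent n pn n∣m l pl l∣m l<n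

      survivor-good : GoodOddPos m
      survivor-good = s≤s z≤n , (∣W⇒∤m (s≤s (s≤s z≤n)) (small∣W (s≤s (m^n>0 2 i₀)))) , good m squarefree local

  positiveLowerDensity : PositiveLowerDensity GoodOddPos
  positiveLowerDensity = density-of-progression W (2 ^ (i₀ + W) * 2 ^ (i₀ + W))
    (*-mono-≤ (m^n>0 2 (i₀ + W)) (m^n>0 2 (i₀ + W))) Range.badness Range.totalBadness
    Range.Survivor.survivor-good

-- The choice `pred (2 ^ 16)` makes i₀ equal to 2^16, the first index that `Large` admits.
theorem3 : PositiveLowerDensity GoodOddPos
theorem3 = Sieve.positiveLowerDensity (pred (2 ^ 16)) ≤-refl
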